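{- Let $p\in\mathcal P$ and let $n\geqslant 0$ be an integer. Let $24_p^{ -1}$ denote the integer satisfying $24\cdot 24_p^{ -1}\equiv 1\pmod p$ chosen so that $1\leqslant -24_p^{ -1}\leqslant p-1$. Then for every integer $\alpha$ with $0\leqslant \alpha<p$ and $\alpha\neq\lfloor p/24\rfloor$, $$b_3\big(2(p^2n+p\alpha-24_p^{ -1})\big)\equiv 0\pmod 2.$$
   Context: For a positive integer $n$, $b_3(n)$ denotes the number of $3$-regular partitions of $n$, i.e. partitions of $n$ none of whose parts is divisible by $3$ (with $b_3(0)=1$); equivalently $\sum_{n\ge0}b_3(n)q^n=\prod_{k\ge1}\frac{1-q^{3k}}{1-q^k}$. A solution $(x,y)\in\mathbb Z^2$ of a Diophantine equation is called primitive if $\gcd(x,y)=1$. $\mathcal P$ denotes the set of primes $p$ such that for some $j\in\{1,4,8\}$ the equation $x^2+216y^2=jp$ has a primitive solution. -}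

module Defs where

open import Data.Nat using (ℕ; zero; suc; _+_; _*_; _∸_; _≤?_)
open import Data.Nat.DivMod using (_%_)
open import Data.Nat.Primality using (Prime)
open import Data.Integer as ℤ using (ℤ; +_)
open import Data.Integer.GCD using () renaming (gcd to gcdℤ)
open import Data.Product using (Σ; _×_; ∃)
open import Data.Sum using (_⊎_)
open import Relation.Nullary using (yes; no)
open import Relation.Binary.PropositionalEquality using (_≡_)

-- cnt k n = number of partitions of n all of whose parts lie in {1,…,k}
-- and are not divisible by 3.  For part size (suc k) not divisible by 3 we
-- sum over the multiplicity j of that part: Σ_{j ≥ 0, j(k+1) ≤ n} cnt k (n − j(k+1)).
cnt : ℕ → ℕ → ℕ
cnt zero zero = 1
cnt zero (suc _) = 0
cnt (suc k) n with suc k % 3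
... | zero = cnt k n
... | suc _ = go n n
  where
  -- go fuel r = Σ_{j ≥ 0, j(k+1) ≤ r} cnt k (r − j(k+1))   (fuel ≥ r suffices)
  go : ℕ → ℕ → ℕ
  go zero r = cnt k r
  go (suc f) r with suc k ≤? r
  ... | yes _ = cnt k r + go f (r ∸ suc k)
  ... | no _ = cnt k r

b₃ : ℕ → ℕ
b₃ n = cnt n n

InP : ℕ → Set
InP p = Prime p × ∃ λ (j : ℕ) → (j ≡ 1 ⊎ j ≡ 4 ⊎ j ≡ 8) ×
          Σ ℤ λ x → Σ ℤ λ y → gcdℤ x y ≡ + 1 ×
            (x ℤ.* x ℤ.+ + 216 ℤ.* (y ℤ.* y) ≡ + (j * p))

{-# OPTIONS --safe #-}

-- Let C = ∑ b₃(n) qⁿ = ∏ (1 - q^{3k}) / (1 - q^k) and P = ∑ q^{s(3s+1)/2} over s ∈ ℤ.  Modulo 2,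
-- Euler's pentagonal number theorem gives C(q) P(q) ≡ P(q³); multiplying by P,
-- C(q) P(q²) ≡ P(q) P(q³).  The even part of the right-hand side is P(q⁴) T(q²) with
-- T = 1 + ∑ q^{(3k+1)²}: for lattice points this is multiplication by a cube root of unity
-- in ℤ[ω].  Cancelling P, ∑ b₃(2n) qⁿ ≡ P T, so b₃(2n) is congruent to the number of
-- solutions of x² + 24y² = 24n + 1 with x ≡ 1 (mod 6) and y = 0 or y ≡ 1 (mod 3).
--
-- A prime p ∈ 𝒫 provides ρ = A + B√-216 of norm p², with p ∤ B and A ≡ p (mod 6).  When p
-- divides N = 24n + 1 exactly once, N is no square, so y ≠ 0, and for each solution
-- α = x + 2y√-6 exactly one of αρ/p, αρ̄/p is integral.  That element is again a solution,
-- in the same residue classes, and this pairs the solutions off without fixed points.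
module Submission where

open import Defs
open import Data.Nat using (ℕ; _+_; _*_; _^_; _≤_; _<_)
open import Relation.Binary.PropositionalEquality using (_≢_)
open import Data.Nat.DivMod using (_/_)
open import Data.Nat.Divisibility using (_∣_)

open import Algebra.Bundles using (CommutativeRing)
open import Data.Empty using (⊥; ⊥-elim)
open import Data.Fin using (Fin; toℕ; fromℕ<)
import Data.Fin.Properties as Fin
open import Data.Integer as ℤ using (ℤ; +_; -[1+_]; ∣_∣)
import Data.Integer.DivMod as ℤ
open import Data.Integer.Divisibility.Signed as ℤ∣
  using () renaming (_∣_ to _∣ℤ_; divides to dividesℤ)
import Data.Integer.Properties as ℤ
import Data.Integer.Tactic.RingSolver as ℤ-Solver
open import Data.List using (List; []; _∷_; _++_; map; filter; length; cartesianProduct)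
open import Data.List.Membership.Propositional using (_∈_; _∉_)
open import Data.List.Membership.Propositional.Properties
  using (∈-map⁺; ∈-map⁻; ∈-++⁺ˡ; ∈-++⁺ʳ; ∈-++⁻; ∈-∃++; ∈-filter⁺; ∈-filter⁻;
         ∈-cartesianProduct⁺; ∈-cartesianProduct⁻)
open import Data.List.Membership.Propositional.Properties.WithK using (unique∧set⇒bag)
open import Data.List.Properties using (length-++; length-map; filter-accept; filter-reject)
open import Data.List.Relation.Binary.BagAndSetEquality using (∼bag⇒↭)
open import Data.List.Relation.Binary.Permutation.Propositional
  using (_↭_; prep; ↭-sym; ↭⇒↭ₛ)
open import Data.List.Relation.Binary.Permutation.Propositional.Properties
  using (∈-resp-↭; ↭-length) renaming (shift to ↭-shift)
open import Data.List.Relation.Binary.Permutation.Setoid.Properties using (Unique-resp-↭)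
open import Data.List.Relation.Unary.All as All using (All; []; _∷_)
open import Data.List.Relation.Unary.AllPairs using ([]; _∷_)
open import Data.List.Relation.Unary.Any using (here; there)
open import Data.List.Relation.Unary.Unique.Propositional using (Unique)
open import Data.List.Relation.Unary.Unique.Propositional.Properties
  using (++⁺; map⁺; filter⁺; cartesianProduct⁺; Unique[x∷xs]⇒x∉xs)
open import Data.Maybe using (Maybe; just; nothing)
open import Data.Nat using (zero; suc; z≤n; s≤s; s≤s⁻¹; _∸_; _⊔_; _≤?_; parity; >-nonZero)
open import Data.Nat.DivMod
  using (_%_; [m+kn]%n≡m%n; m%n<n; m<n⇒m%n≡m; %-distribˡ-*; m≡m%n+[m/n]*n; m/n<m)
open import Data.Nat.Divisibility using (∣1⇒≡1; divides; >⇒∤)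
import Data.Nat.Divisibility as ℕ∣
open import Data.Nat.Primality using (Prime; euclidsLemma; ¬prime[1]; prime[2]; prime⇒nonZero)
import Data.Nat.Properties as ℕ
import Data.Nat.Tactic.RingSolver as ℕ-Solver
open import Data.Parity.Base as ℙ using (Parity; 0ℙ; 1ℙ)
import Data.Parity.Properties as ℙ
open import Data.Product using (∃; _×_; _,_; proj₁; proj₂)
open import Data.Sum as Sum using (_⊎_; inj₁; inj₂)
open import Data.Sum.Properties using (inj₁-injective; inj₂-injective)
open import Function using (_∘_; case_of_; mk⇔)
open import Relation.Binary.PropositionalEquality
  using (_≡_; refl; sym; trans; cong; cong₂; subst; setoid; module ≡-Reasoning)
open import Relation.Nullary using (¬_; yes; no; contradiction)
open import Relation.Nullary.Decidable using (toWitness; _→-dec_)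
open import Algebra.Properties.CommutativeSemigroup
  (CommutativeRing.+-commutativeSemigroup ℙ.+-*-commutativeRing)
  using (interchange; x∙yz≈y∙xz)
open import Algebra.Properties.Group (CommutativeRing.+-group ℤ.+-*-commutativeRing)
  using () renaming (∙-cancelˡ to +ℤ-cancelˡ; ∙-cancelʳ to +ℤ-cancelʳ)

-- Power series over 𝔽₂

Series : Set
Series = ℕ → Parity

infix 4 _≈_
_≈_ : Series → Series → Set
f ≈ g = ∀ n → f n ≡ g n

tail : Series → Series
tail f n = f (suc n)

infixl 6 _⊕_
_⊕_ : Series → Series → Series
(f ⊕ g) n = f n ℙ.+ g n

𝟎 𝟏 : Series
𝟎 _ = 0ℙ
𝟏 zero = 1ℙ
𝟏 (suc _) = 0ℙ

infixl 7 _⊛_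
_⊛_ : Series → Series → Series
(f ⊛ g) zero = f 0 ℙ.* g 0
(f ⊛ g) (suc n) = f 0 ℙ.* g (suc n) ℙ.+ (tail f ⊛ g) n

⊛-cong≤ : ∀ {f f′ g g′} n → (∀ i → i ≤ n → f i ≡ f′ i) → (∀ i → i ≤ n → g i ≡ g′ i) →
  (f ⊛ g) n ≡ (f′ ⊛ g′) n
⊛-cong≤ zero f≡ g≡ = cong₂ ℙ._*_ (f≡ 0 z≤n) (g≡ 0 z≤n)
⊛-cong≤ (suc n) f≡ g≡ = cong₂ ℙ._+_
  (cong₂ ℙ._*_ (f≡ 0 z≤n) (g≡ (suc n) ℕ.≤-refl))
  (⊛-cong≤ n (λ i i≤n → f≡ (suc i) (s≤s i≤n)) (λ i i≤n → g≡ i (ℕ.m≤n⇒m≤1+n i≤n)))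

⊛-cong : ∀ {f f′ g g′} → f ≈ f′ → g ≈ g′ → f ⊛ g ≈ f′ ⊛ g′
⊛-cong f≈ g≈ n = ⊛-cong≤ n (λ i _ → f≈ i) (λ i _ → g≈ i)

⊛-distribʳ-⊕ : ∀ h f g → (f ⊕ g) ⊛ h ≈ f ⊛ h ⊕ g ⊛ h
⊛-distribʳ-⊕ h f g zero = ℙ.*-distribʳ-+ (h 0) (f 0) (g 0)
⊛-distribʳ-⊕ h f g (suc n) = trans
  (cong₂ ℙ._+_ (ℙ.*-distribʳ-+ (h (suc n)) (f 0) (g 0)) (⊛-distribʳ-⊕ h (tail f) (tail g) n))
  (interchange (f 0 ℙ.* h (suc n)) (g 0 ℙ.* h (suc n)) _ _)

⊛-scaleˡ : ∀ c f g n → ((λ i → c ℙ.* f i) ⊛ g) n ≡ c ℙ.* (f ⊛ g) n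
⊛-scaleˡ 0ℙ f g zero = refl
⊛-scaleˡ 0ℙ f g (suc n) = ⊛-scaleˡ 0ℙ (tail f) g n
⊛-scaleˡ 1ℙ f g n = refl

⊛-tailʳ : ∀ f g n → (f ⊛ g) (suc n) ≡ f (suc n) ℙ.* g 0 ℙ.+ (f ⊛ tail g) n
⊛-tailʳ f g zero = ℙ.+-comm (f 0 ℙ.* g 1) (f 1 ℙ.* g 0)
⊛-tailʳ f g (suc n) = trans
  (cong (f 0 ℙ.* g (suc (suc n)) ℙ.+_) (⊛-tailʳ (tail f) g n))
  (x∙yz≈y∙xz (f 0 ℙ.* g (suc (suc n))) (f (suc (suc n)) ℙ.* g 0) _)

⊛-comm : ∀ f g → f ⊛ g ≈ g ⊛ f
⊛-comm f g zero = ℙ.*-comm (f 0) (g 0)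
⊛-comm f g (suc n) = trans
  (cong₂ ℙ._+_ (ℙ.*-comm (f 0) (g (suc n))) (⊛-comm (tail f) g n))
  (sym (⊛-tailʳ g f n))

⊛-assoc : ∀ f g h → (f ⊛ g) ⊛ h ≈ f ⊛ (g ⊛ h)
⊛-assoc f g h zero = ℙ.*-assoc (f 0) (g 0) (h 0)
⊛-assoc f g h (suc n) = begin
  f 0 ℙ.* g 0 ℙ.* h (suc n) ℙ.+ (((λ i → f 0 ℙ.* g (suc i)) ⊕ tail f ⊛ g) ⊛ h) n
    ≡⟨ cong₂ ℙ._+_ (ℙ.*-assoc (f 0) (g 0) _)
         (⊛-distribʳ-⊕ h (λ i → f 0 ℙ.* g (suc i)) (tail f ⊛ g) n) ⟩
  f 0 ℙ.* (g 0 ℙ.* h (suc n)) ℙ.+ (((λ i → f 0 ℙ.* g (suc i)) ⊛ h) n ℙ.+ ((tail f ⊛ g) ⊛ h) n)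
    ≡⟨ cong (f 0 ℙ.* (g 0 ℙ.* h (suc n)) ℙ.+_)
         (cong₂ ℙ._+_ (⊛-scaleˡ (f 0) (tail g) h n) (⊛-assoc (tail f) g h n)) ⟩
  f 0 ℙ.* (g 0 ℙ.* h (suc n)) ℙ.+ (f 0 ℙ.* (tail g ⊛ h) n ℙ.+ (tail f ⊛ (g ⊛ h)) n)
    ≡⟨ ℙ.+-assoc (f 0 ℙ.* (g 0 ℙ.* h (suc n))) _ _ ⟨
  f 0 ℙ.* (g 0 ℙ.* h (suc n)) ℙ.+ (f 0 ℙ.* (tail g ⊛ h) n) ℙ.+ (tail f ⊛ (g ⊛ h)) n
    ≡⟨ cong (ℙ._+ (tail f ⊛ (g ⊛ h)) n) (ℙ.*-distribˡ-+ (f 0) (g 0 ℙ.* h (suc n)) _) ⟨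
  f 0 ℙ.* (g 0 ℙ.* h (suc n) ℙ.+ (tail g ⊛ h) n) ℙ.+ (tail f ⊛ (g ⊛ h)) n ∎
  where open ≡-Reasoning

⊛-zeroˡ : ∀ f → 𝟎 ⊛ f ≈ 𝟎
⊛-zeroˡ f zero = refl
⊛-zeroˡ f (suc n) = ⊛-zeroˡ f n

⊛-identityˡ : ∀ f → 𝟏 ⊛ f ≈ f
⊛-identityˡ f zero = refl
⊛-identityˡ f (suc n) = trans (cong (f (suc n) ℙ.+_) (⊛-zeroˡ f n)) (ℙ.+-identityʳ (f (suc n)))

⊛-cancelˡ : ∀ f {g h} → f 0 ≡ 1ℙ → f ⊛ g ≈ f ⊛ h → g ≈ h
⊛-cancelˡ f {g} {h} f0≡1 fg≈fh n = below n n ℕ.≤-refl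
  where
  unscale : ∀ x y → f 0 ℙ.* x ≡ f 0 ℙ.* y → x ≡ y
  unscale x y eq rewrite f0≡1 = eq

  below : ∀ n i → i ≤ n → g i ≡ h i
  below zero .zero z≤n = unscale _ _ (fg≈fh 0)
  below (suc n) i i≤ with ℕ.m≤n⇒m<n∨m≡n i≤
  ... | inj₁ i<1+n = below n i (s≤s⁻¹ i<1+n)
  ... | inj₂ refl = unscale _ _ (ℙ.+-cancelʳ-≡ ((tail f ⊛ g) n) _ _ (trans (fg≈fh (suc n))
          (cong (f 0 ℙ.* h (suc n) ℙ.+_) (⊛-cong≤ n (λ _ _ → refl) (λ i i≤n → sym (below n i i≤n))))))

⊛-even : ∀ f g → (∀ i → g (suc (2 * i)) ≡ 0ℙ) →
  ∀ n → (f ⊛ g) (2 * n) ≡ ((λ i → f (2 * i)) ⊛ (λ i → g (2 * i))) n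
⊛-even f g odd≡0 n = go n f
  where
  double : ∀ i → 2 * suc i ≡ suc (suc (2 * i))
  double = ℕ-Solver.solve-∀

  go : ∀ n f → (f ⊛ g) (2 * n) ≡ ((λ i → f (2 * i)) ⊛ (λ i → g (2 * i))) n
  go zero f = refl
  go (suc n) f = begin
    (f ⊛ g) (2 * suc n)
      ≡⟨ cong (f ⊛ g) (double n) ⟩
    f 0 ℙ.* g (suc (suc (2 * n))) ℙ.+ (f 1 ℙ.* g (suc (2 * n)) ℙ.+ (tail (tail f) ⊛ g) (2 * n))
      ≡⟨ cong₂ (λ x y → f 0 ℙ.* g x ℙ.+ (y ℙ.+ (tail (tail f) ⊛ g) (2 * n))) (sym (double n))
           (trans (cong (f 1 ℙ.*_) (odd≡0 n)) (ℙ.*-zeroʳ (f 1))) ⟩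
    f 0 ℙ.* g (2 * suc n) ℙ.+ (tail (tail f) ⊛ g) (2 * n)
      ≡⟨ cong (f 0 ℙ.* g (2 * suc n) ℙ.+_) (go n (tail (tail f))) ⟩
    f 0 ℙ.* g (2 * suc n) ℙ.+ ((λ i → f (suc (suc (2 * i)))) ⊛ (λ i → g (2 * i))) n
      ≡⟨ cong (f 0 ℙ.* g (2 * suc n) ℙ.+_)
           (⊛-cong≤ n (λ i _ → cong f (sym (double i))) (λ _ _ → refl)) ⟩
    f 0 ℙ.* g (2 * suc n) ℙ.+ ((λ i → f (2 * suc i)) ⊛ (λ i → g (2 * i))) n ∎
    where open ≡-Reasoning

shift : ℕ → Series → Series
shift zero f n = f n
shift (suc e) f zero = 0ℙ
shift (suc e) f (suc n) = shift e f n

shift-cong : ∀ e {f g} → f ≈ g → shift e f ≈ shift e g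
shift-cong zero f≈g n = f≈g n
shift-cong (suc e) f≈g zero = refl
shift-cong (suc e) f≈g (suc n) = shift-cong e f≈g n

shift-⊕ : ∀ e f g → shift e (f ⊕ g) ≈ shift e f ⊕ shift e g
shift-⊕ zero f g n = refl
shift-⊕ (suc e) f g zero = refl
shift-⊕ (suc e) f g (suc n) = shift-⊕ e f g n

shift-+ : ∀ d e f → shift d (shift e f) ≈ shift (d + e) f
shift-+ zero e f n = refl
shift-+ (suc d) e f zero = refl
shift-+ (suc d) e f (suc n) = shift-+ d e f n

shift-< : ∀ e f {n} → n < e → shift e f n ≡ 0ℙ
shift-< (suc e) f {zero} _ = refl
shift-< (suc e) f {suc n} n<e = shift-< e f (s≤s⁻¹ n<e)

shift-≥ : ∀ e f {n} → e ≤ n → shift e f n ≡ f (n ∸ e)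
shift-≥ zero f e≤n = refl
shift-≥ (suc e) f {suc n} e≤n = shift-≥ e f (s≤s⁻¹ e≤n)

shift-⊛ : ∀ e f g → shift e f ⊛ g ≈ shift e (f ⊛ g)
shift-⊛ zero f g n = refl
shift-⊛ (suc e) f g zero = refl
shift-⊛ (suc e) f g (suc n) = shift-⊛ e f g n

monomial-≡ : ∀ n → shift n 𝟏 n ≡ 1ℙ
monomial-≡ zero = refl
monomial-≡ (suc n) = monomial-≡ n

monomial-≢ : ∀ e n → e ≢ n → shift e 𝟏 n ≡ 0ℙ
monomial-≢ zero zero e≢n = contradiction refl e≢n
monomial-≢ zero (suc n) e≢n = refl
monomial-≢ (suc e) zero e≢n = refl
monomial-≢ (suc e) (suc n) e≢n = monomial-≢ e n (e≢n ∘ cong suc)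

mul1+ : ℕ → Series → Series
mul1+ e f = f ⊕ shift e f

mul1+-cong : ∀ e {f g} → f ≈ g → mul1+ e f ≈ mul1+ e g
mul1+-cong e f≈g n = cong₂ ℙ._+_ (f≈g n) (shift-cong e f≈g n)

mul1+-⊛ : ∀ e f g → mul1+ e f ⊛ g ≈ mul1+ e (f ⊛ g)
mul1+-⊛ e f g n = trans (⊛-distribʳ-⊕ g f (shift e f) n) (cong ((f ⊛ g) n ℙ.+_) (shift-⊛ e f g n))

mul1+-⊛ʳ : ∀ e f g → f ⊛ mul1+ e g ≈ mul1+ e (f ⊛ g)
mul1+-⊛ʳ e f g n = trans (⊛-comm f (mul1+ e g) n)
  (trans (mul1+-⊛ e g f n) (mul1+-cong e (⊛-comm g f) n))

mul1+-comm : ∀ d e f → mul1+ d (mul1+ e f) ≈ mul1+ e (mul1+ d f)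
mul1+-comm d e f n = begin
  (f n ℙ.+ shift e f n) ℙ.+ shift d (mul1+ e f) n
    ≡⟨ cong (f n ℙ.+ shift e f n ℙ.+_) (trans (shift-⊕ d f (shift e f) n)
         (cong (shift d f n ℙ.+_) (trans (shift-+ d e f n)
           (trans (cong (λ x → shift x f n) (ℕ.+-comm d e)) (sym (shift-+ e d f n)))))) ⟩
  (f n ℙ.+ shift e f n) ℙ.+ (shift d f n ℙ.+ shift e (shift d f) n)
    ≡⟨ interchange (f n) (shift e f n) (shift d f n) _ ⟩
  (f n ℙ.+ shift d f n) ℙ.+ (shift e f n ℙ.+ shift e (shift d f) n)
    ≡⟨ cong (f n ℙ.+ shift d f n ℙ.+_) (shift-⊕ e f (shift d f) n) ⟨
  mul1+ e (mul1+ d f) n ∎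
  where open ≡-Reasoning

mul1+-< : ∀ e f {n} → n < e → mul1+ e f n ≡ f n
mul1+-< e f {n} n<e = trans (cong (f n ℙ.+_) (shift-< e f n<e)) (ℙ.+-identityʳ (f n))

mul1+-shift : ∀ d e f → mul1+ d (shift e f) ≈ shift e (mul1+ d f)
mul1+-shift d e f n = trans
  (cong (shift e f n ℙ.+_) (trans (shift-+ d e f n)
    (trans (cong (λ x → shift x f n) (ℕ.+-comm d e)) (sym (shift-+ e d f n)))))
  (sym (shift-⊕ e f (shift d f) n))

-- Shanks' finite form of Euler's pentagonal number theorem, with q^d in place of q

triangle : ℕ → ℕ
triangle zero = 0
triangle (suc n) = suc n + triangle n

pent : ℤ → ℕ
pent (+ n) = n * n + triangle n
pent -[1+ n ] = suc n * suc n + triangle n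

box : ℕ → List ℤ
box zero = + 0 ∷ []
box (suc n) = + suc n ∷ -[1+ n ] ∷ box n

theta : ∀ {X : Set} → (X → ℕ) → List X → Series
theta w [] = 𝟎
theta w (x ∷ xs) = shift (w x) 𝟏 ⊕ theta w xs

module Shanks (d : ℕ) where

  -- ∏ (1 + q^{di}) over s < i ≤ s + m
  prod : ℕ → ℕ → Series
  prod s zero = 𝟏
  prod s (suc m) = mul1+ (d * (s + suc m)) (prod s m)

  term : ℕ → ℕ → Series
  term s m = shift (d * (s * (s + m) + triangle s)) (prod s m)

  -- ∑ term i (s + m ∸ i) over s ≤ i ≤ s + m
  partialSum : ℕ → ℕ → Series
  partialSum s zero = term s 0
  partialSum s (suc m) = term s (suc m) ⊕ partialSum (suc s) m

  pentPair : ℕ → Series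
  pentPair n = shift (d * pent (+ suc n)) 𝟏 ⊕ shift (d * pent -[1+ n ]) 𝟏

  prod-bottom : ∀ s m → prod s (suc m) ≈ mul1+ (d * suc s) (prod (suc s) m)
  prod-bottom s zero n = cong (λ e → mul1+ (d * e) 𝟏 n) (ℕ.+-comm s 1)
  prod-bottom s (suc m) n = begin
    mul1+ (d * (s + suc (suc m))) (prod s (suc m)) n
      ≡⟨ mul1+-cong (d * (s + suc (suc m))) (prod-bottom s m) n ⟩
    mul1+ (d * (s + suc (suc m))) (mul1+ (d * suc s) (prod (suc s) m)) n
      ≡⟨ mul1+-comm (d * (s + suc (suc m))) (d * suc s) (prod (suc s) m) n ⟩
    mul1+ (d * suc s) (mul1+ (d * (s + suc (suc m))) (prod (suc s) m)) n
      ≡⟨ cong (λ e → mul1+ (d * suc s) (mul1+ (d * e) (prod (suc s) m)) n) (ℕ.+-suc s (suc m)) ⟩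
    mul1+ (d * suc s) (prod (suc s) (suc m)) n ∎
    where open ≡-Reasoning

  term-top : ∀ s m n → term s (suc m) n ≡
    shift (d * s) (term s m) n ℙ.+ shift (d * s + d * (s + suc m)) (term s m) n
  term-top s m n = begin
    shift (d * (s * (s + suc m) + triangle s)) (mul1+ e (prod s m)) n
      ≡⟨ cong (λ x → shift x (mul1+ e (prod s m)) n) (exponent d s m (triangle s)) ⟩
    shift (d * s + c) (mul1+ e (prod s m)) n
      ≡⟨ shift-+ (d * s) c (mul1+ e (prod s m)) n ⟨
    shift (d * s) (shift c (mul1+ e (prod s m))) n
      ≡⟨ shift-cong (d * s) (mul1+-shift e c (prod s m)) n ⟨
    shift (d * s) (mul1+ e (term s m)) n
      ≡⟨ shift-⊕ (d * s) (term s m) (shift e (term s m)) n ⟩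
    shift (d * s) (term s m) n ℙ.+ shift (d * s) (shift e (term s m)) n
      ≡⟨ cong (shift (d * s) (term s m) n ℙ.+_) (shift-+ (d * s) e (term s m) n) ⟩
    shift (d * s) (term s m) n ℙ.+ shift (d * s + e) (term s m) n ∎
    where
    open ≡-Reasoning
    e = d * (s + suc m)
    c = d * (s * (s + m) + triangle s)

    exponent : ∀ d s m t → d * (s * (s + suc m) + t) ≡ d * s + d * (s * (s + m) + t)
    exponent = ℕ-Solver.solve-∀

  term-bottom : ∀ s m → shift (d * s + d * (s + suc (suc m))) (term s (suc m))
    ≈ mul1+ (d * suc s) (term (suc s) m)
  term-bottom s m n = begin
    shift e (term s (suc m)) n
      ≡⟨ shift-+ e _ (prod s (suc m)) n ⟩
    shift (e + d * (s * (s + suc m) + triangle s)) (prod s (suc m)) n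
      ≡⟨ cong (λ x → shift x (prod s (suc m)) n) (exponent d s m (triangle s)) ⟩
    shift c (prod s (suc m)) n
      ≡⟨ shift-cong c (prod-bottom s m) n ⟩
    shift c (mul1+ (d * suc s) (prod (suc s) m)) n
      ≡⟨ mul1+-shift (d * suc s) c (prod (suc s) m) n ⟨
    mul1+ (d * suc s) (term (suc s) m) n ∎
    where
    open ≡-Reasoning
    e = d * s + d * (s + suc (suc m))
    c = d * (suc s * (suc s + m) + triangle (suc s))

    exponent : ∀ d s m t → d * s + d * (s + suc (suc m)) + d * (s * (s + suc m) + t)
      ≡ d * (suc s * (suc s + m) + (suc s + t))
    exponent = ℕ-Solver.solve-∀

  telescope : ∀ s m n → partialSum s (suc m) n ℙ.+ partialSum s m n
    ≡ mul1+ (d * s) (term s m) n ℙ.+ pentPair (s + m) n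
  telescope s zero n = begin
    (term s 1 n ℙ.+ term (suc s) 0 n) ℙ.+ a
      ≡⟨ cong₂ (λ u v → (u ℙ.+ v) ℙ.+ a) (term-top s 0 n)
           (cong (λ e → shift (d * e) 𝟏 n) (exponent⁺ s (triangle s))) ⟩
    ((x ℙ.+ shift (d * s + d * (s + 1)) (term s 0) n) ℙ.+ z) ℙ.+ a
      ≡⟨ cong (λ u → ((x ℙ.+ u) ℙ.+ z) ℙ.+ a) (trans
           (shift-+ (d * s + d * (s + 1)) _ 𝟏 n)
           (cong (λ e → shift e 𝟏 n) (exponent⁻ d s (triangle s)))) ⟩
    ((x ℙ.+ y) ℙ.+ z) ℙ.+ a
      ≡⟨ rearrange x y z a ⟩
    (a ℙ.+ x) ℙ.+ (z ℙ.+ y)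
      ≡⟨ cong (λ k → a ℙ.+ x ℙ.+ pentPair k n) (ℕ.+-identityʳ s) ⟨
    mul1+ (d * s) (term s 0) n ℙ.+ pentPair (s + 0) n ∎
    where
    open ≡-Reasoning
    a = term s 0 n
    x = shift (d * s) (term s 0) n
    y = shift (d * pent -[1+ s ]) 𝟏 n
    z = shift (d * pent (+ suc s)) 𝟏 n

    exponent⁺ : ∀ s t → suc s * (suc s + 0) + (suc s + t) ≡ suc s * suc s + (suc s + t)
    exponent⁺ = ℕ-Solver.solve-∀

    exponent⁻ : ∀ d s t → d * s + d * (s + 1) + d * (s * (s + 0) + t) ≡ d * (suc s * suc s + t)
    exponent⁻ = ℕ-Solver.solve-∀

    rearrange : ∀ x y z a → ((x ℙ.+ y) ℙ.+ z) ℙ.+ a ≡ (a ℙ.+ x) ℙ.+ (z ℙ.+ y)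
    rearrange x y z a = trans (ℙ.+-comm (x ℙ.+ y ℙ.+ z) a) (trans
      (cong (a ℙ.+_) (trans (ℙ.+-assoc x y z) (cong (x ℙ.+_) (ℙ.+-comm y z))))
      (sym (ℙ.+-assoc a x (z ℙ.+ y))))
  telescope s (suc m) n = begin
    (term s (suc (suc m)) n ℙ.+ partialSum (suc s) (suc m) n) ℙ.+ (a ℙ.+ partialSum (suc s) m n)
      ≡⟨ interchange (term s (suc (suc m)) n) _ a _ ⟩
    (term s (suc (suc m)) n ℙ.+ a) ℙ.+ (partialSum (suc s) (suc m) n ℙ.+ partialSum (suc s) m n)
      ≡⟨ cong₂ (λ u v → (u ℙ.+ a) ℙ.+ v)
           (trans (term-top s (suc m) n) (cong (x ℙ.+_) (term-bottom s m n)))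
           (trans (telescope (suc s) m n) (cong (λ k → y ℙ.+ pentPair k n) (sym (ℕ.+-suc s m)))) ⟩
    ((x ℙ.+ y) ℙ.+ a) ℙ.+ (y ℙ.+ pentPair (s + suc m) n)
      ≡⟨ cancel-y x y a _ ⟩
    (a ℙ.+ x) ℙ.+ pentPair (s + suc m) n ∎
    where
    open ≡-Reasoning
    a = term s (suc m) n
    x = shift (d * s) (term s (suc m)) n
    y = mul1+ (d * suc s) (term (suc s) m) n

    cancel-y : ∀ x y a l → ((x ℙ.+ y) ℙ.+ a) ℙ.+ (y ℙ.+ l) ≡ (a ℙ.+ x) ℙ.+ l
    cancel-y x 0ℙ a l = cong (ℙ._+ l) (trans (cong (ℙ._+ a) (ℙ.+-identityʳ x)) (ℙ.+-comm x a))
    cancel-y 0ℙ 1ℙ 0ℙ 0ℙ = refl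
    cancel-y 0ℙ 1ℙ 0ℙ 1ℙ = refl
    cancel-y 0ℙ 1ℙ 1ℙ 0ℙ = refl
    cancel-y 0ℙ 1ℙ 1ℙ 1ℙ = refl
    cancel-y 1ℙ 1ℙ 0ℙ 0ℙ = refl
    cancel-y 1ℙ 1ℙ 0ℙ 1ℙ = refl
    cancel-y 1ℙ 1ℙ 1ℙ 0ℙ = refl
    cancel-y 1ℙ 1ℙ 1ℙ 1ℙ = refl

  partialSum-pent : ∀ m → partialSum 0 m ≈ theta (λ s → d * pent s) (box m)
  partialSum-pent zero n = trans (cong (λ e → shift e 𝟏 n) (ℕ.*-zeroʳ d)) (sym (trans
    (ℙ.+-identityʳ (shift (d * 0) 𝟏 n)) (cong (λ e → shift e 𝟏 n) (ℕ.*-zeroʳ d))))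
  partialSum-pent (suc m) n = ℙ.+-cancelʳ-≡ (partialSum 0 m n) _ _ (begin
    partialSum 0 (suc m) n ℙ.+ partialSum 0 m n
      ≡⟨ telescope 0 m n ⟩
    mul1+ (d * 0) (term 0 m) n ℙ.+ pentPair m n
      ≡⟨ cong (λ e → mul1+ e (term 0 m) n ℙ.+ pentPair m n) (ℕ.*-zeroʳ d) ⟩
    (term 0 m n ℙ.+ term 0 m n) ℙ.+ pentPair m n
      ≡⟨ cong (ℙ._+ pentPair m n) (ℙ.p+p≡0ℙ (term 0 m n)) ⟩
    shift (d * pent (+ suc m)) 𝟏 n ℙ.+ shift (d * pent -[1+ m ]) 𝟏 n
      ≡⟨ cancel-last (shift (d * pent (+ suc m)) 𝟏 n) _ _ ⟨
    (shift (d * pent (+ suc m)) 𝟏 n ℙ.+ (shift (d * pent -[1+ m ]) 𝟏 n ℙ.+ partialSum 0 m n))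
      ℙ.+ partialSum 0 m n
      ≡⟨ cong (λ u → (shift (d * pent (+ suc m)) 𝟏 n ℙ.+ (shift (d * pent -[1+ m ]) 𝟏 n ℙ.+ u))
           ℙ.+ partialSum 0 m n) (partialSum-pent m n) ⟩
    theta (λ s → d * pent s) (box (suc m)) n ℙ.+ partialSum 0 m n ∎)
    where
    open ≡-Reasoning

    cancel-last : ∀ x y z → (x ℙ.+ (y ℙ.+ z)) ℙ.+ z ≡ x ℙ.+ y
    cancel-last x y z = begin
      (x ℙ.+ (y ℙ.+ z)) ℙ.+ z  ≡⟨ ℙ.+-assoc x (y ℙ.+ z) z ⟩
      x ℙ.+ ((y ℙ.+ z) ℙ.+ z)  ≡⟨ cong (x ℙ.+_) (ℙ.+-assoc y z z) ⟩
      x ℙ.+ (y ℙ.+ (z ℙ.+ z))  ≡⟨ cong (λ u → x ℙ.+ (y ℙ.+ u)) (ℙ.p+p≡0ℙ z) ⟩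
      x ℙ.+ (y ℙ.+ 0ℙ)         ≡⟨ cong (x ℙ.+_) (ℙ.+-identityʳ y) ⟩
      x ℙ.+ y ∎

  module _ (1≤d : 1 ≤ d) where

    term-low : ∀ s m {n} → n ≤ suc s + m → term (suc s) m n ≡ 0ℙ
    term-low s m n≤ = shift-< _ (prod (suc s) m) (ℕ.≤-<-trans n≤ (ℕ.≤-trans exponent (ℕ.m≤n*m _ d)))
      where
      instance _ = >-nonZero 1≤d

      exponent : suc s + m < suc s * (suc s + m) + triangle (suc s)
      exponent = ℕ.<-≤-trans (ℕ.m<m+n (suc s + m) (s≤s z≤n))
        (ℕ.+-monoˡ-≤ (triangle (suc s)) (ℕ.m≤n*m (suc s + m) (suc s)))

    partialSum-low : ∀ s m {n} → n ≤ suc s + m → partialSum (suc s) m n ≡ 0ℙ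
    partialSum-low s zero n≤ = term-low s 0 n≤
    partialSum-low s (suc m) n≤ = cong₂ ℙ._+_ (term-low s (suc m) n≤)
      (partialSum-low (suc s) m (ℕ.≤-trans n≤ (ℕ.≤-reflexive (ℕ.+-suc (suc s) m))))

    prod-pent : ∀ n → prod 0 n n ≡ theta (λ s → d * pent s) (box n) n
    prod-pent n = trans (sym (trans (first n) (cong (λ e → shift e (prod 0 n) n) (ℕ.*-zeroʳ d))))
      (partialSum-pent n n)
      where
      first : ∀ n → partialSum 0 n n ≡ term 0 n n
      first zero = refl
      first (suc n) = trans (cong (term 0 (suc n) (suc n) ℙ.+_) (partialSum-low 0 n ℕ.≤-refl))
        (ℙ.+-identityʳ _)

    prod-stable : ∀ n k → prod 0 (k + n) n ≡ prod 0 n n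
    prod-stable n zero = refl
    prod-stable n (suc k) = trans
      (mul1+-< (d * suc (k + n)) (prod 0 (k + n)) (ℕ.≤-trans (s≤s (ℕ.m≤n+m n k)) (ℕ.m≤n*m _ d)))
      (prod-stable n k)
      where instance _ = >-nonZero 1≤d

-- Finite sets and the parity of their cardinality

record CardParity {X : Set} (S : X → Set) (c : Parity) : Set where
  field
    elements : List X
    unique   : Unique elements
    sound    : ∀ {x} → x ∈ elements → S x
    complete : ∀ {x} → S x → x ∈ elements
    value    : c ≡ parity (length elements)

parity-length-++ : ∀ {X : Set} (xs ys : List X) →
  parity (length (xs ++ ys)) ≡ parity (length xs) ℙ.+ parity (length ys)
parity-length-++ xs ys = trans (cong parity (length-++ xs)) (ℙ.+-homo-+ (length xs) (length ys))

CardParity-resp : ∀ {X : Set} {S T : X → Set} {c} → (∀ {x} → S x → T x) → (∀ {x} → T x → S x) →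
  CardParity S c → CardParity T c
CardParity-resp S⇒T T⇒S s = record
  { elements = elements ; unique = unique ; sound = S⇒T ∘ sound ; complete = complete ∘ T⇒S
  ; value = value }
  where open CardParity s

CardParity-∪ : ∀ {X : Set} {S T : X → Set} {c d} → (∀ {x} → S x → T x → ⊥) →
  CardParity S c → CardParity T d → CardParity (λ x → S x ⊎ T x) (c ℙ.+ d)
CardParity-∪ disjoint s t = record
  { elements = S.elements ++ T.elements
  ; unique   = ++⁺ S.unique T.unique (λ (x∈S , x∈T) → disjoint (S.sound x∈S) (T.sound x∈T))
  ; sound    = Sum.map S.sound T.sound ∘ ∈-++⁻ S.elements
  ; complete = Sum.[ ∈-++⁺ˡ ∘ S.complete , ∈-++⁺ʳ S.elements ∘ T.complete ]
  ; value    = trans (cong₂ ℙ._+_ S.value T.value) (sym (parity-length-++ S.elements T.elements))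
  }
  where
  module S = CardParity s
  module T = CardParity t

CardParity-image : ∀ {X Y : Set} {S : X → Set} {c} (f : X → Y) → (∀ {x x′} → f x ≡ f x′ → x ≡ x′) →
  CardParity S c → CardParity (λ y → ∃ λ x → S x × y ≡ f x) c
CardParity-image f f-injective s = record
  { elements = map f elements
  ; unique   = map⁺ f-injective unique
  ; sound    = λ y∈ → let x , x∈ , y≡fx = ∈-map⁻ f y∈ in x , sound x∈ , y≡fx
  ; complete = λ { (x , Sx , refl) → ∈-map⁺ f (complete Sx) }
  ; value    = trans value (cong parity (sym (length-map f elements)))
  }
  where open CardParity s

CardParity-⊎ : ∀ {X Y : Set} {S : X → Set} {T : Y → Set} {c d} → CardParity S c → CardParity T d →
  CardParity Sum.[ S , T ] (c ℙ.+ d)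
CardParity-⊎ {S = S} {T} s t = CardParity-resp
  (λ { (inj₁ (x , Sx , refl)) → Sx ; (inj₂ (y , Ty , refl)) → Ty })
  (λ { {inj₁ x} Sx → inj₁ (x , Sx , refl) ; {inj₂ y} Ty → inj₂ (y , Ty , refl) })
  (CardParity-∪ (λ { (x , _ , refl) (y , _ , ()) })
    (CardParity-image inj₁ inj₁-injective s) (CardParity-image inj₂ inj₂-injective t))

CardParity-× : ∀ {X Y : Set} {S : X → Set} {T : Y → Set} {c d} → CardParity S c → CardParity T d →
  CardParity (λ (x , y) → S x × T y) (c ℙ.* d)
CardParity-× s t = record
  { elements = cartesianProduct S.elements T.elements
  ; unique   = cartesianProduct⁺ S.unique T.unique
  ; sound    = λ p → let x∈ , y∈ = ∈-cartesianProduct⁻ S.elements T.elements p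
                     in S.sound x∈ , T.sound y∈
  ; complete = λ (Sx , Ty) → ∈-cartesianProduct⁺ (S.complete Sx) (T.complete Ty)
  ; value    = trans (cong₂ ℙ._*_ S.value T.value) (trans
      (sym (ℙ.*-homo-* (length S.elements) (length T.elements)))
      (cong parity (sym (length-cartesianProduct S.elements T.elements))))
  }
  where
  module S = CardParity s
  module T = CardParity t

  length-cartesianProduct : ∀ {X Y : Set} (xs : List X) (ys : List Y) →
    length (cartesianProduct xs ys) ≡ length xs * length ys
  length-cartesianProduct [] ys = refl
  length-cartesianProduct (x ∷ xs) ys = trans (length-++ (map (x ,_) ys))
    (cong₂ _+_ (length-map (x ,_) ys) (length-cartesianProduct xs ys))

Convolution : ∀ {X Y : Set} → (ℕ → X → Set) → (ℕ → Y → Set) → ℕ → X × Y → Set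
Convolution S T n (x , y) = ∃ λ i → ∃ λ j → i + j ≡ n × S i x × T j y

CardParity-⊛ : ∀ {X Y : Set} {S : ℕ → X → Set} {T : ℕ → Y → Set} {f g} →
  (∀ {x i j} → S i x → S j x → i ≡ j) →
  (∀ n → CardParity (S n) (f n)) → (∀ n → CardParity (T n) (g n)) →
  ∀ n → CardParity (Convolution S T n) ((f ⊛ g) n)
CardParity-⊛ {S = S} {T} disjoint s t zero = CardParity-resp {T = Convolution S T 0}
  (λ (Sx , Ty) → 0 , 0 , refl , Sx , Ty)
  (λ { (zero , .0 , refl , Sx , Ty) → Sx , Ty })
  (CardParity-× (s 0) (t 0))
CardParity-⊛ {S = S} {T} disjoint s t (suc n) = CardParity-resp {T = Convolution S T (suc n)}
  (λ { (inj₁ (Sx , Ty)) → 0 , suc n , refl , Sx , Ty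
     ; (inj₂ (i , j , refl , Sx , Ty)) → suc i , j , refl , Sx , Ty })
  (λ { (zero , .(suc n) , refl , Sx , Ty) → inj₁ (Sx , Ty)
     ; (suc i , j , refl , Sx , Ty) → inj₂ (i , j , refl , Sx , Ty) })
  (CardParity-∪ (λ { (Sx , _) (i , j , _ , S′x , _) → case disjoint Sx S′x of λ () })
    (CardParity-× (s 0) (t (suc n)))
    (CardParity-⊛ {S = S ∘ suc} (λ Sx S′x → ℕ.suc-injective (disjoint Sx S′x)) (s ∘ suc) t n))

Represents : ∀ {X : Set} → (X → ℕ) → Series → Set
Represents w f = ∀ n → CardParity (λ x → w x ≡ n) (f n)

Represents-⊛ : ∀ {X Y : Set} {w : X → ℕ} {w′ : Y → ℕ} {f g} → Represents w f → Represents w′ g →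
  Represents (λ (x , y) → w x + w′ y) (f ⊛ g)
Represents-⊛ {w = w} {w′} s t n = CardParity-resp
  {S = Convolution (λ i x → w x ≡ i) (λ j y → w′ y ≡ j) n}
  (λ { (i , j , refl , refl , refl) → refl })
  (λ { {x , y} eq → w x , w′ y , eq , refl , refl })
  (CardParity-⊛ (λ { refl refl → refl }) s t n)

Represents-theta : ∀ {X : Set} (w : X → ℕ) (boxes : ℕ → List X) → (∀ n → Unique (boxes n)) →
  (∀ x → x ∈ boxes (w x)) → Represents w (λ n → theta w (boxes n) n)
Represents-theta {X} w boxes boxes-unique x∈boxes n = record
  { elements = filter (λ x → w x ℕ.≟ n) (boxes n)
  ; unique   = filter⁺ (λ x → w x ℕ.≟ n) (boxes-unique n)
  ; sound    = proj₂ ∘ ∈-filter⁻ (λ x → w x ℕ.≟ n) {xs = boxes n}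
  ; complete = λ { {x} refl → ∈-filter⁺ (λ y → w y ℕ.≟ w x) (x∈boxes x) refl }
  ; value    = coefficient (boxes n)
  }
  where
  coefficient : ∀ xs → theta w xs n ≡ parity (length (filter (λ x → w x ℕ.≟ n) xs))
  coefficient [] = refl
  coefficient (x ∷ xs) with w x ℕ.≟ n
  ... | yes refl = trans (cong₂ ℙ._+_ (monomial-≡ (w x)) (coefficient xs)) (trans
    (sym (ℙ.+-homo-+ 1 (length (filter (λ y → w y ℕ.≟ w x) xs))))
    (cong (parity ∘ length) (sym (filter-accept (λ y → w y ℕ.≟ w x) refl))))
  ... | no wx≢n = trans (cong₂ ℙ._+_ (monomial-≢ (w x) n wx≢n) (coefficient xs))
    (cong (parity ∘ length) (sym (filter-reject (λ y → w y ℕ.≟ n) wx≢n)))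

record PerfectMatching {X : Set} (S : X → Set) (R : X → X → Set) : Set where
  field
    symmetric   : ∀ {x y} → R x y → R y x
    irreflexive : ∀ {x} → S x → ¬ R x x
    functional  : ∀ {x y z} → S x → S y → S z → R x y → R x z → y ≡ z
    partner     : ∀ {x} → S x → ∃ λ y → S y × R x y

matching⇒even : ∀ {X : Set} {S : X → Set} {c} {R : X → X → Set} → PerfectMatching S R →
  CardParity S c → c ≡ 0ℙ
matching⇒even {X} {S} {c} {R} matching s =
  trans value (even (length elements) elements ℕ.≤-refl unique sound
    (λ x∈ → let y , Sy , Rxy = partner (sound x∈) in y , complete Sy , Rxy))
  where
  open CardParity s
  open PerfectMatching matching

  even : ∀ n xs → length xs ≤ n → Unique xs → (∀ {x} → x ∈ xs → S x) →
    (∀ {x} → x ∈ xs → ∃ λ y → y ∈ xs × R x y) → parity (length xs) ≡ 0ℙ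
  even n [] _ _ _ _ = refl
  even (suc n) (x ∷ xs) (s≤s len≤n) uniq inS mate with mate (here refl)
  ... | y , here refl , Rxx = contradiction Rxx (irreflexive (inS (here refl)))
  ... | y , there y∈xs , Rxy with ∈-∃++ y∈xs
  ... | ys , zs , refl = trans (cong parity (↭-length σ))
          (even n (ys ++ zs) (ℕ.≤-trans (ℕ.n≤1+n _) (ℕ.≤-trans
            (ℕ.≤-reflexive (ℕ.suc-injective (sym (↭-length σ)))) len≤n))
            uniq′ (inS ∘ back) mate′)
    where
    σ : x ∷ ys ++ y ∷ zs ↭ x ∷ y ∷ ys ++ zs
    σ = prep x (↭-shift y ys zs)

    back : ∀ {z} → z ∈ ys ++ zs → z ∈ x ∷ ys ++ y ∷ zs
    back z∈ = ∈-resp-↭ (↭-sym σ) (there (there z∈))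

    uniqσ : Unique (x ∷ y ∷ ys ++ zs)
    uniqσ = Unique-resp-↭ (setoid X) (↭⇒↭ₛ σ) uniq

    uniq′ : Unique (ys ++ zs)
    uniq′ with _ ∷ _ ∷ u ← uniqσ = u

    x∉ : x ∉ ys ++ zs
    x∉ x∈ = Unique[x∷xs]⇒x∉xs uniqσ (there x∈)

    y∉ : y ∉ ys ++ zs
    y∉ with _ ∷ u ← uniqσ = Unique[x∷xs]⇒x∉xs u

    Sx = inS (here refl)
    Sy = inS (there y∈xs)

    mate′ : ∀ {z} → z ∈ ys ++ zs → ∃ λ w → w ∈ ys ++ zs × R z w
    mate′ {z} z∈ with mate (back z∈)
    ... | w , w∈ , Rzw with ∈-resp-↭ σ w∈
    ... | there (there w∈′) = w , w∈′ , Rzw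
    ... | here refl = contradiction
            (subst (_∈ ys ++ zs) (functional Sx (inS (back z∈)) Sy (symmetric Rzw) Rxy) z∈) y∉
    ... | there (here refl) = contradiction
            (subst (_∈ ys ++ zs) (functional Sy (inS (back z∈)) Sx (symmetric Rzw) (symmetric Rxy)) z∈) x∉

matching⇒≡ : ∀ {X Y : Set} {S : X → Set} {T : Y → Set} {c d} {R : X ⊎ Y → X ⊎ Y → Set} →
  PerfectMatching Sum.[ S , T ] R → CardParity S c → CardParity T d → c ≡ d
matching⇒≡ {c = c} {d} matching s t = ℙ.+-cancelʳ-≡ d c d
  (trans (matching⇒even matching (CardParity-⊎ s t)) (sym (ℙ.p+p≡0ℙ d)))

∈-box : ∀ s n → ∣ s ∣ ≤ n → s ∈ box n
∈-box (+ zero) zero _ = here refl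
∈-box (+ m) (suc n) m≤ with ℕ.m≤n⇒m<n∨m≡n m≤
... | inj₁ m<1+n = there (there (∈-box (+ m) n (s≤s⁻¹ m<1+n)))
... | inj₂ refl = here refl
∈-box -[1+ m ] (suc n) m< with ℕ.m≤n⇒m<n∨m≡n (s≤s⁻¹ m<)
... | inj₁ m<n = there (there (∈-box -[1+ m ] n m<n))
... | inj₂ refl = there (here refl)

box-sound : ∀ {s} n → s ∈ box n → ∣ s ∣ ≤ n
box-sound zero (here refl) = z≤n
box-sound (suc n) (here refl) = ℕ.≤-refl
box-sound (suc n) (there (here refl)) = ℕ.≤-refl
box-sound (suc n) (there (there s∈)) = ℕ.m≤n⇒m≤1+n (box-sound n s∈)

box-unique : ∀ n → Unique (box n)
box-unique zero = [] ∷ []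
box-unique (suc n) =
  ((λ ()) ∷ outside (+ suc n) ℕ.≤-refl) ∷ outside -[1+ n ] ℕ.≤-refl ∷ box-unique n
  where
  outside : ∀ s → suc n ≤ ∣ s ∣ → All (s ≢_) (box n)
  outside s n<∣s∣ = All.tabulate (λ { x∈ refl → ℕ.<⇒≱ n<∣s∣ (box-sound n x∈) })

∣s∣≤pent : ∀ s → ∣ s ∣ ≤ pent s
∣s∣≤pent (+ zero) = z≤n
∣s∣≤pent (+ suc n) = ℕ.≤-trans (ℕ.m≤n*m (suc n) (suc n)) (ℕ.m≤m+n _ _)
∣s∣≤pent -[1+ n ] = ℕ.≤-trans (ℕ.m≤n*m (suc n) (suc n)) (ℕ.m≤m+n _ _)

pentSeries : ℕ → Series
pentSeries d n = theta (λ s → d * pent s) (box n) n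

Represents-pent : ∀ d → 1 ≤ d → Represents (λ s → d * pent s) (pentSeries d)
Represents-pent d 1≤d = Represents-theta (λ s → d * pent s) box box-unique
  (λ s → ∈-box s _ (ℕ.≤-trans (∣s∣≤pent s) (ℕ.m≤n*m (pent s) d)))
  where instance _ = >-nonZero 1≤d

-- Exponents of 1 + ∑ q^{(3k+1)²}; nothing stands for the constant term.
squareWeight : Maybe ℤ → ℕ
squareWeight nothing = 0
squareWeight (just k) = ∣ + 3 ℤ.* k ℤ.+ + 1 ∣ * ∣ + 3 ℤ.* k ℤ.+ + 1 ∣

squareBox : ℕ → List (Maybe ℤ)
squareBox n = nothing ∷ map just (box n)

squareSeries : Series
squareSeries n = theta squareWeight (squareBox n) n

Represents-square : Represents squareWeight squareSeries
Represents-square = Represents-theta squareWeight squareBox unique′ member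
  where
  unique′ : ∀ n → Unique (squareBox n)
  unique′ n = All.tabulate (λ x∈ → λ { refl → case ∈-map⁻ just x∈ of λ () })
    ∷ map⁺ (λ { refl → refl }) (box-unique n)

  ∣k∣≤ : ∀ k → ∣ k ∣ ≤ ∣ + 3 ℤ.* k ℤ.+ + 1 ∣
  ∣k∣≤ (+ k) = subst (λ z → k ≤ ∣ z ℤ.+ + 1 ∣) (ℤ.pos-* 3 k)
    (ℕ.≤-trans (ℕ.m≤n*m k 3) (ℕ.m≤m+n _ 1))
  ∣k∣≤ -[1+ k ] rewrite ℕ.+-suc k (k + 1 * suc k) = s≤s (ℕ.m≤m+n k _)

  member : ∀ m → m ∈ squareBox (squareWeight m)
  member nothing = here refl
  member (just k) = there (∈-map⁺ just (∈-box k _ (ℕ.≤-trans (∣k∣≤ k) (n≤n*n _))))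
    where
    n≤n*n : ∀ n → n ≤ n * n
    n≤n*n zero = z≤n
    n≤n*n n@(suc _) = ℕ.m≤n*m n n

-- The generating function of b₃

sumMult : ℕ → ℕ → ℕ → ℕ
sumMult k zero r = cnt k r
sumMult k (suc f) r with suc k ≤? r
... | yes _ = cnt k r + sumMult k f (r ∸ suc k)
... | no _ = cnt k r

-- The local function of cnt has no name here: the underscore in the type of
-- go≡sumMult is solved to it by the call in cnt≡sumMult.
mutual
  cnt≡sumMult : ∀ k n → suc k % 3 ≢ 0 → cnt (suc k) n ≡ sumMult k n n
  cnt≡sumMult k zero ≢0 with suc k % 3
  ... | zero = contradiction refl ≢0
  ... | suc _ = refl
  cnt≡sumMult k (suc n) ≢0 with suc k % 3
  ... | zero = contradiction refl ≢0
  ... | suc w with suc k ≤? suc n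
  ... | no _ = refl
  ... | yes _ with suc n | suc n ∸ suc k
  ... | N | r = cong (λ c → cnt k N + c) (go≡sumMult k N w n r)

  go≡sumMult : ∀ k N w f r → _ ≡ sumMult k f r
  go≡sumMult k N w zero r = refl
  go≡sumMult k N w (suc f) r with suc k ≤? r
  ... | yes _ = cong (λ c → cnt k r + c) (go≡sumMult k N w f (r ∸ suc k))
  ... | no _ = refl

∸-fuel : ∀ {k f r} → r ≤ suc f → r ∸ suc k ≤ f
∸-fuel {k} {f} {zero} _ = z≤n
∸-fuel {k} {f} {suc r} r≤ = ℕ.≤-trans (ℕ.m∸n≤m r k) (s≤s⁻¹ r≤)

sumMult-fuel : ∀ k f g r → r ≤ f → r ≤ g → sumMult k f r ≡ sumMult k g r
sumMult-fuel k zero zero r _ _ = refl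
sumMult-fuel k zero (suc g) zero _ _ = refl
sumMult-fuel k (suc f) zero zero _ _ = refl
sumMult-fuel k (suc f) (suc g) r r≤f r≤g with suc k ≤? r
... | yes _ = cong (λ c → cnt k r + c)
        (sumMult-fuel k f g (r ∸ suc k) (∸-fuel {k} r≤f) (∸-fuel {k} r≤g))
... | no _ = refl

cnt-multiple : ∀ k n → suc k % 3 ≡ 0 → cnt (suc k) n ≡ cnt k n
cnt-multiple k n ≡0 with suc k % 3
... | zero = refl

cnt-nonmultiple-< : ∀ k n → suc k % 3 ≢ 0 → n < suc k → cnt (suc k) n ≡ cnt k n
cnt-nonmultiple-< k zero ≢0 n< = cnt≡sumMult k 0 ≢0
cnt-nonmultiple-< k (suc n) ≢0 n< rewrite cnt≡sumMult k (suc n) ≢0 with suc k ≤? suc n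
... | yes k<n = contradiction k<n (ℕ.<⇒≱ n<)
... | no _ = refl

cnt-nonmultiple-≥ : ∀ k n → suc k % 3 ≢ 0 → suc k ≤ n →
  cnt (suc k) n ≡ cnt k n + cnt (suc k) (n ∸ suc k)
cnt-nonmultiple-≥ k (suc n) ≢0 k<n
  rewrite cnt≡sumMult k (suc n) ≢0 | cnt≡sumMult k (n ∸ k) ≢0 with suc k ≤? suc n
... | yes _ = cong (λ c → cnt k (suc n) + c)
        (sumMult-fuel k n (n ∸ k) (n ∸ k) (ℕ.m∸n≤m n k) ℕ.≤-refl)
... | no k≮n = contradiction k<n k≮n

cnt-< : ∀ k n → n < suc k → cnt (suc k) n ≡ cnt k n
cnt-< k n n< with suc k % 3 ℕ.≟ 0
... | yes ≡0 = cnt-multiple k n ≡0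
... | no ≢0 = cnt-nonmultiple-< k n ≢0 n<

cnt-stable : ∀ k n → cnt (k + n) n ≡ b₃ n
cnt-stable zero n = refl
cnt-stable (suc k) n = trans (cnt-< (k + n) n (s≤s (ℕ.m≤n+m n k))) (cnt-stable k n)

cntSeries : ℕ → Series
cntSeries k n = parity (cnt k n)

cntSeries-step : ∀ k → suc k % 3 ≢ 0 → mul1+ (suc k) (cntSeries (suc k)) ≈ cntSeries k
cntSeries-step k ≢0 n with suc k ≤? n
... | no k≮n = trans (mul1+-< (suc k) (cntSeries (suc k)) (ℕ.≰⇒> k≮n))
        (cong parity (cnt-< k n (ℕ.≰⇒> k≮n)))
... | yes k<n = begin
    parity (cnt (suc k) n) ℙ.+ shift (suc k) (cntSeries (suc k)) n
      ≡⟨ cong₂ ℙ._+_ (trans (cong parity (cnt-nonmultiple-≥ k n ≢0 k<n)) (ℙ.+-homo-+ (cnt k n) _))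
           (shift-≥ (suc k) (cntSeries (suc k)) k<n) ⟩
    (parity (cnt k n) ℙ.+ c) ℙ.+ c
      ≡⟨ ℙ.+-assoc (parity (cnt k n)) c c ⟩
    parity (cnt k n) ℙ.+ (c ℙ.+ c)
      ≡⟨ cong (parity (cnt k n) ℙ.+_) (ℙ.p+p≡0ℙ c) ⟩
    parity (cnt k n) ℙ.+ 0ℙ
      ≡⟨ ℙ.+-identityʳ _ ⟩
    parity (cnt k n) ∎
    where
    open ≡-Reasoning
    c = cntSeries (suc k) (n ∸ suc k)

open Shanks using (prod; prod-pent; prod-stable)

prod-cnt-nonmultiple : ∀ k → suc k % 3 ≢ 0 →
  prod 1 0 (suc k) ⊛ cntSeries (suc k) ≈ prod 1 0 k ⊛ cntSeries k
prod-cnt-nonmultiple k ≢0 n = begin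
  (mul1+ (1 * suc k) (prod 1 0 k) ⊛ c) n
    ≡⟨ cong (λ e → (mul1+ e (prod 1 0 k) ⊛ c) n) (ℕ.*-identityˡ (suc k)) ⟩
  (mul1+ (suc k) (prod 1 0 k) ⊛ c) n
    ≡⟨ mul1+-⊛ (suc k) (prod 1 0 k) c n ⟩
  mul1+ (suc k) (prod 1 0 k ⊛ c) n
    ≡⟨ mul1+-⊛ʳ (suc k) (prod 1 0 k) c n ⟨
  (prod 1 0 k ⊛ mul1+ (suc k) c) n
    ≡⟨ ⊛-cong {f = prod 1 0 k} (λ _ → refl) (cntSeries-step k ≢0) n ⟩
  (prod 1 0 k ⊛ cntSeries k) n ∎
  where
  open ≡-Reasoning
  c = cntSeries (suc k)

prod-cnt-multiple : ∀ k → suc k % 3 ≡ 0 →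
  prod 1 0 (suc k) ⊛ cntSeries (suc k) ≈ mul1+ (suc k) (prod 1 0 k ⊛ cntSeries k)
prod-cnt-multiple k ≡0 n = begin
  (mul1+ (1 * suc k) (prod 1 0 k) ⊛ cntSeries (suc k)) n
    ≡⟨ cong (λ e → (mul1+ e (prod 1 0 k) ⊛ cntSeries (suc k)) n) (ℕ.*-identityˡ (suc k)) ⟩
  (mul1+ (suc k) (prod 1 0 k) ⊛ cntSeries (suc k)) n
    ≡⟨ mul1+-⊛ (suc k) (prod 1 0 k) (cntSeries (suc k)) n ⟩
  mul1+ (suc k) (prod 1 0 k ⊛ cntSeries (suc k)) n
    ≡⟨ mul1+-cong (suc k) (⊛-cong {f = prod 1 0 k} (λ _ → refl)
         (λ i → cong parity (cnt-multiple k i ≡0))) n ⟩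
  mul1+ (suc k) (prod 1 0 k ⊛ cntSeries k) n ∎
  where open ≡-Reasoning

prod-cnt : ∀ j → prod 1 0 (j * 3) ⊛ cntSeries (j * 3) ≈ prod 3 0 j
prod-cnt zero n = trans (⊛-identityˡ (cntSeries 0) n) (cnt-zero n)
  where
  cnt-zero : cntSeries 0 ≈ 𝟏
  cnt-zero zero = refl
  cnt-zero (suc n) = refl
prod-cnt (suc j) n = begin
  (prod 1 0 (3 + k) ⊛ cntSeries (3 + k)) n
    ≡⟨ prod-cnt-multiple (2 + k) ([m+kn]%n≡m%n 3 j 3) n ⟩
  mul1+ (3 + k) (prod 1 0 (2 + k) ⊛ cntSeries (2 + k)) n
    ≡⟨ mul1+-cong (3 + k) (prod-cnt-nonmultiple (1 + k) (nonzero 2 (λ ()))) n ⟩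
  mul1+ (3 + k) (prod 1 0 (1 + k) ⊛ cntSeries (1 + k)) n
    ≡⟨ mul1+-cong (3 + k) (prod-cnt-nonmultiple k (nonzero 1 (λ ()))) n ⟩
  mul1+ (3 + k) (prod 1 0 k ⊛ cntSeries k) n
    ≡⟨ mul1+-cong (3 + k) (prod-cnt j) n ⟩
  mul1+ (3 + k) (prod 3 0 j) n
    ≡⟨ cong (λ e → mul1+ e (prod 3 0 j) n) (ℕ.*-comm (suc j) 3) ⟩
  prod 3 0 (suc j) n ∎
  where
  open ≡-Reasoning
  k = j * 3

  nonzero : ∀ r → r % 3 ≢ 0 → (r + k) % 3 ≢ 0
  nonzero r r≢0 eq = r≢0 (trans (sym ([m+kn]%n≡m%n r j 3)) eq)

b₃Series : Series
b₃Series n = parity (b₃ n)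

pent-b₃ : pentSeries 1 ⊛ b₃Series ≈ pentSeries 3
pent-b₃ n = begin
  (pentSeries 1 ⊛ b₃Series) n
    ≡⟨ ⊛-cong≤ n
         (λ i i≤n → trans (sym (prod-pent 1 (s≤s z≤n) i)) (trans
           (sym (prod-stable 1 (s≤s z≤n) i (n * 3 ∸ i)))
           (cong (λ m → prod 1 0 m i) (ℕ.m∸n+n≡m (i≤3n i≤n)))))
         (λ i i≤n → cong parity (trans (sym (cnt-stable (n * 3 ∸ i) i))
           (cong (λ m → cnt m i) (ℕ.m∸n+n≡m (i≤3n i≤n))))) ⟩
  (prod 1 0 (n * 3) ⊛ cntSeries (n * 3)) n
    ≡⟨ prod-cnt n n ⟩
  prod 3 0 n n
    ≡⟨ prod-pent 3 (s≤s z≤n) n ⟩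
  pentSeries 3 n ∎
  where
  open ≡-Reasoning

  i≤3n : ∀ {i} → i ≤ n → i ≤ n * 3
  i≤3n i≤n = ℕ.≤-trans i≤n (ℕ.m≤m*n n 3)

CardParity-unique : ∀ {X : Set} {S : X → Set} {c d} → CardParity S c → CardParity S d → c ≡ d
CardParity-unique s s′ = trans S.value (trans
  (cong parity (↭-length (∼bag⇒↭ (unique∧set⇒bag S.unique S′.unique
    (mk⇔ (S′.complete ∘ S.sound) (S.complete ∘ S′.sound))))))
  (sym S′.value))
  where
  module S = CardParity s
  module S′ = CardParity s′

CardParity-∅ : ∀ {X : Set} {S : X → Set} {c} → (∀ {x} → ¬ S x) → CardParity S c → c ≡ 0ℙ
CardParity-∅ ∅ = matching⇒even {R = λ _ _ → ⊥} (record
  { symmetric = λ () ; irreflexive = λ _ () ; functional = λ _ _ _ ()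
  ; partner = λ Sx → contradiction Sx ∅ })

even≢odd : ∀ a b → + 2 ℤ.* a ≢ + 2 ℤ.* b ℤ.+ + 1
even≢odd a b eq = 2n≢1 ∣ a ℤ.- b ∣ (trans (sym (ℤ.abs-* (+ 2) (a ℤ.- b))) (cong ∣_∣ difference))
  where
  2n≢1 : ∀ n → 2 * n ≢ 1
  2n≢1 (suc n) eq rewrite ℕ.+-suc n (n + 0) = case eq of λ ()

  expand : ∀ a b → + 2 ℤ.* (a ℤ.- b) ≡ + 2 ℤ.* a ℤ.- + 2 ℤ.* b
  expand = ℤ-Solver.solve-∀

  collapse : ∀ b → + 2 ℤ.* b ℤ.+ + 1 ℤ.- + 2 ℤ.* b ≡ + 1
  collapse = ℤ-Solver.solve-∀

  difference : + 2 ℤ.* (a ℤ.- b) ≡ + 1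
  difference = trans (expand a b) (trans (cong (ℤ._- + 2 ℤ.* b) eq) (collapse b))

pent-double : ∀ s → + (2 * pent s) ≡ s ℤ.* (+ 3 ℤ.* s ℤ.+ + 1)
pent-double s = trans (ℤ.pos-* 2 (pent s)) (go s)
  where
  triangle-double : ∀ n → 2 * triangle n ≡ n * suc n
  triangle-double zero = refl
  triangle-double (suc n) = trans (ℕ.*-distribˡ-+ 2 (suc n) (triangle n))
    (trans (cong (λ x → 2 * suc n + x) (triangle-double n)) (expand n))
    where
    expand : ∀ n → 2 * suc n + n * suc n ≡ suc n * suc (suc n)
    expand = ℕ-Solver.solve-∀

  triangle-doubleℤ : ∀ n → + 2 ℤ.* + triangle n ≡ + n ℤ.* (+ 1 ℤ.+ + n)
  triangle-doubleℤ n = trans (sym (ℤ.pos-* 2 (triangle n)))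
    (trans (cong +_ (triangle-double n)) (ℤ.pos-* n (suc n)))

  expand : ∀ x y t → + 2 ℤ.* (x ℤ.* y ℤ.+ t) ≡ + 2 ℤ.* (x ℤ.* y) ℤ.+ + 2 ℤ.* t
  expand = ℤ-Solver.solve-∀

  positive : ∀ x → + 2 ℤ.* (x ℤ.* x) ℤ.+ x ℤ.* (+ 1 ℤ.+ x) ≡ x ℤ.* (+ 3 ℤ.* x ℤ.+ + 1)
  positive = ℤ-Solver.solve-∀

  negative : ∀ x → let y = + 1 ℤ.+ x in
    + 2 ℤ.* (y ℤ.* y) ℤ.+ x ℤ.* (+ 1 ℤ.+ x) ≡ ℤ.- y ℤ.* (+ 3 ℤ.* ℤ.- y ℤ.+ + 1)
  negative = ℤ-Solver.solve-∀

  go : ∀ s → + 2 ℤ.* + pent s ≡ s ℤ.* (+ 3 ℤ.* s ℤ.+ + 1)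
  go (+ n) = begin
    + 2 ℤ.* (+ (n * n) ℤ.+ + triangle n)
      ≡⟨ cong (λ z → + 2 ℤ.* (z ℤ.+ + triangle n)) (ℤ.pos-* n n) ⟩
    + 2 ℤ.* (+ n ℤ.* + n ℤ.+ + triangle n)
      ≡⟨ expand (+ n) (+ n) (+ triangle n) ⟩
    + 2 ℤ.* (+ n ℤ.* + n) ℤ.+ + 2 ℤ.* + triangle n
      ≡⟨ cong (λ z → + 2 ℤ.* (+ n ℤ.* + n) ℤ.+ z) (triangle-doubleℤ n) ⟩
    + 2 ℤ.* (+ n ℤ.* + n) ℤ.+ + n ℤ.* (+ 1 ℤ.+ + n)
      ≡⟨ positive (+ n) ⟩
    + n ℤ.* (+ 3 ℤ.* + n ℤ.+ + 1) ∎
    where open ≡-Reasoning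
  go -[1+ n ] = begin
    + 2 ℤ.* (+ (suc n * suc n) ℤ.+ + triangle n)
      ≡⟨ cong (λ z → + 2 ℤ.* (z ℤ.+ + triangle n)) (ℤ.pos-* (suc n) (suc n)) ⟩
    + 2 ℤ.* (+ suc n ℤ.* + suc n ℤ.+ + triangle n)
      ≡⟨ expand (+ suc n) (+ suc n) (+ triangle n) ⟩
    + 2 ℤ.* (+ suc n ℤ.* + suc n) ℤ.+ + 2 ℤ.* + triangle n
      ≡⟨ cong (λ z → + 2 ℤ.* (+ suc n ℤ.* + suc n) ℤ.+ z) (triangle-doubleℤ n) ⟩
    + 2 ℤ.* (+ suc n ℤ.* + suc n) ℤ.+ + n ℤ.* (+ 1 ℤ.+ + n)
      ≡⟨ negative (+ n) ⟩
    -[1+ n ] ℤ.* (+ 3 ℤ.* -[1+ n ] ℤ.+ + 1) ∎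
    where open ≡-Reasoning

∣z∣²≡z² : ∀ z → + (∣ z ∣ * ∣ z ∣) ≡ z ℤ.* z
∣z∣²≡z² (+ n) = ℤ.pos-* n n
∣z∣²≡z² -[1+ n ] = refl

+2*-cancel : ∀ {m n} → + (2 * m) ≡ + (2 * n) → m ≡ n
+2*-cancel {m} {n} eq = ℕ.*-cancelˡ-≡ m n 2 (ℤ.+-injective eq)

pent²-swap : pentSeries 1 ⊛ pentSeries 1 ≈ pentSeries 2
pent²-swap n = matching⇒≡ {R = R} matching
  (Represents-⊛ (Represents-pent 1 (s≤s z≤n)) (Represents-pent 1 (s≤s z≤n)) n)
  (Represents-pent 2 (s≤s z≤n) n)
  where
  R : (ℤ × ℤ) ⊎ ℤ → (ℤ × ℤ) ⊎ ℤ → Set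
  R (inj₁ (s , t)) (inj₁ (s′ , t′)) = s ≢ t × s′ ≡ t × t′ ≡ s
  R (inj₁ (s , t)) (inj₂ r) = s ≡ r × t ≡ r
  R (inj₂ r) (inj₁ (s , t)) = s ≡ r × t ≡ r
  R (inj₂ _) (inj₂ _) = ⊥

  S : (ℤ × ℤ) ⊎ ℤ → Set
  S = Sum.[ (λ (s , t) → 1 * pent s + 1 * pent t ≡ n) , (λ r → 2 * pent r ≡ n) ]

  double : ∀ k → 1 * k + 1 * k ≡ 2 * k
  double = ℕ-Solver.solve-∀

  matching : PerfectMatching S R
  matching = record
    { symmetric = λ
        { {inj₁ _} {inj₁ _} (s≢t , refl , refl) → s≢t ∘ sym , refl , refl
        ; {inj₁ _} {inj₂ _} Rxy → Rxy
        ; {inj₂ _} {inj₁ _} Rxy → Rxy }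
    ; irreflexive = λ { {inj₁ _} _ (s≢t , s≡t , _) → s≢t s≡t }
    ; functional = λ
        { {inj₁ _} {inj₁ _} {inj₁ _} _ _ _ (_ , refl , refl) (_ , refl , refl) → refl
        ; {inj₁ _} {inj₁ _} {inj₂ _} _ _ _ (s≢t , _) (refl , refl) → contradiction refl s≢t
        ; {inj₁ _} {inj₂ _} {inj₁ _} _ _ _ (refl , refl) (s≢t , _) → contradiction refl s≢t
        ; {inj₁ _} {inj₂ _} {inj₂ _} _ _ _ (refl , _) (refl , _) → refl
        ; {inj₂ _} {inj₁ _} {inj₁ _} _ _ _ (refl , refl) (refl , refl) → refl }
    ; partner = λ
        { {inj₁ (s , t)} Sx → case s ℤ.≟ t of λ
            { (yes refl) → inj₂ s , trans (sym (double (pent s))) Sx , refl , refl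
            ; (no s≢t) → inj₁ (t , s) , trans (ℕ.+-comm (1 * pent t) (1 * pent s)) Sx
                , s≢t , refl , refl }
        ; {inj₂ r} Sx → inj₁ (r , r) , trans (double (pent r)) Sx , refl , refl }
    }

pent₂-even : ∀ n → pentSeries 2 (2 * n) ≡ pentSeries 1 n
pent₂-even n = CardParity-unique (Represents-pent 2 (s≤s z≤n) (2 * n))
  (CardParity-resp
    (λ { {s} eq → cong (2 *_) (trans (sym (ℕ.*-identityˡ (pent s))) eq) })
    (λ { {s} eq → trans (ℕ.*-identityˡ (pent s)) (ℕ.*-cancelˡ-≡ (pent s) n 2 eq) })
    (Represents-pent 1 (s≤s z≤n) n))

pent₂-odd : ∀ n → pentSeries 2 (suc (2 * n)) ≡ 0ℙ
pent₂-odd n = CardParity-∅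
  (λ {s} eq → even≢odd (+ pent s) (+ n) (trans (sym (ℤ.pos-* 2 (pent s)))
    (trans (cong +_ (trans eq (ℕ.+-comm 1 (2 * n)))) (cong (ℤ._+ + 1) (ℤ.pos-* 2 n)))))
  (Represents-pent 2 (s≤s z≤n) (suc (2 * n)))

-- With x = 6s + 1, y = 6t + 1 the pairs (s , t) below are the solutions of
-- x² + 3y² = 48n + 4, and with a = 6r + 1, b = 2(3v + 1) (respectively b = 0) the pairs
-- (r , m) are those of a² + 3b² = 12n + 1.  In ℤ[ω] they are associates, up to units.
module PentagonalDissection where

  pairWeight : ℤ × ℤ → ℕ
  pairWeight (s , t) = 1 * pent s + 3 * pent t

  mixedWeight : ℕ → ℤ × Maybe ℤ → ℕ
  mixedWeight d (r , m) = d * pent r + squareWeight m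

  pairWeight-double : ∀ s t → + (2 * pairWeight (s , t)) ≡
    s ℤ.* (+ 3 ℤ.* s ℤ.+ + 1) ℤ.+ + 3 ℤ.* (t ℤ.* (+ 3 ℤ.* t ℤ.+ + 1))
  pairWeight-double s t = begin
    + (2 * (1 * pent s + 3 * pent t))
      ≡⟨ cong +_ (expand (pent s) (pent t)) ⟩
    + (2 * pent s) ℤ.+ + (3 * (2 * pent t))
      ≡⟨ cong₂ ℤ._+_ (pent-double s)
           (trans (ℤ.pos-* 3 (2 * pent t)) (cong (+ 3 ℤ.*_) (pent-double t))) ⟩
    s ℤ.* (+ 3 ℤ.* s ℤ.+ + 1) ℤ.+ + 3 ℤ.* (t ℤ.* (+ 3 ℤ.* t ℤ.+ + 1)) ∎
    where
    open ≡-Reasoning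

    expand : ∀ x y → 2 * (1 * x + 3 * y) ≡ 2 * x + 3 * (2 * y)
    expand = ℕ-Solver.solve-∀

  mixedWeight-quadruple : ∀ r v → + (2 * (2 * mixedWeight 2 (r , just v))) ≡
    + 4 ℤ.* (r ℤ.* (+ 3 ℤ.* r ℤ.+ + 1)) ℤ.+
    + 4 ℤ.* ((+ 3 ℤ.* v ℤ.+ + 1) ℤ.* (+ 3 ℤ.* v ℤ.+ + 1))
  mixedWeight-quadruple r v = begin
    + (2 * (2 * (2 * pent r + squareWeight (just v))))
      ≡⟨ cong +_ (expand (pent r) (squareWeight (just v))) ⟩
    + (4 * (2 * pent r)) ℤ.+ + (4 * squareWeight (just v))
      ≡⟨ cong₂ ℤ._+_
           (trans (ℤ.pos-* 4 (2 * pent r)) (cong (+ 4 ℤ.*_) (pent-double r)))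
           (trans (ℤ.pos-* 4 (squareWeight (just v)))
             (cong (+ 4 ℤ.*_) (∣z∣²≡z² (+ 3 ℤ.* v ℤ.+ + 1)))) ⟩
    + 4 ℤ.* (r ℤ.* (+ 3 ℤ.* r ℤ.+ + 1)) ℤ.+
      + 4 ℤ.* ((+ 3 ℤ.* v ℤ.+ + 1) ℤ.* (+ 3 ℤ.* v ℤ.+ + 1)) ∎
    where
    open ≡-Reasoning

    expand : ∀ x y → 2 * (2 * (2 * x + y)) ≡ 4 * (2 * x) + 4 * y
    expand = ℕ-Solver.solve-∀

  solve-sum : ∀ s t {c} → s ℤ.+ t ≡ c → s ≡ c ℤ.- t
  solve-sum s t refl = expand s t
    where
    expand : ∀ s t → s ≡ s ℤ.+ t ℤ.- t
    expand = ℤ-Solver.solve-∀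

  pairWeight-swap : ∀ s t s′ t′ → s ℤ.+ t ≡ + 2 ℤ.* t′ → s′ ℤ.+ t′ ≡ + 2 ℤ.* t →
    pairWeight (s , t) ≡ pairWeight (s′ , t′)
  pairWeight-swap s t s′ t′ eq eq′ with refl ← solve-sum s t eq | refl ← solve-sum s′ t′ eq′ =
    +2*-cancel (trans (pairWeight-double s t) (trans (identity t t′) (sym (pairWeight-double s′ t′))))
    where
    identity : ∀ t t′ → let s = + 2 ℤ.* t′ ℤ.- t ; s′ = + 2 ℤ.* t ℤ.- t′ in
      s ℤ.* (+ 3 ℤ.* s ℤ.+ + 1) ℤ.+ + 3 ℤ.* (t ℤ.* (+ 3 ℤ.* t ℤ.+ + 1)) ≡
      s′ ℤ.* (+ 3 ℤ.* s′ ℤ.+ + 1) ℤ.+ + 3 ℤ.* (t′ ℤ.* (+ 3 ℤ.* t′ ℤ.+ + 1))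
    identity = ℤ-Solver.solve-∀

  pairWeight-diagonal : ∀ t → pairWeight (t , t) ≡ 2 * mixedWeight 2 (t , nothing)
  pairWeight-diagonal t = identity (pent t)
    where
    identity : ∀ x → 1 * x + 3 * x ≡ 2 * (2 * x + 0)
    identity = ℕ-Solver.solve-∀

  pairWeight-mixed : ∀ s r v → s ℤ.+ (v ℤ.- r) ≡ + 4 ℤ.* v ℤ.+ + 1 →
    pairWeight (s , v ℤ.- r) ≡ 2 * mixedWeight 2 (r , just v)
  pairWeight-mixed s r v eq with refl ← solve-sum s (v ℤ.- r) eq =
    +2*-cancel (trans (pairWeight-double s (v ℤ.- r))
      (trans (identity r v) (sym (mixedWeight-quadruple r v))))
    where
    identity : ∀ r v → let t = v ℤ.- r ; s = + 4 ℤ.* v ℤ.+ + 1 ℤ.- t in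
      s ℤ.* (+ 3 ℤ.* s ℤ.+ + 1) ℤ.+ + 3 ℤ.* (t ℤ.* (+ 3 ℤ.* t ℤ.+ + 1)) ≡
      + 4 ℤ.* (r ℤ.* (+ 3 ℤ.* r ℤ.+ + 1)) ℤ.+
      + 4 ℤ.* ((+ 3 ℤ.* v ℤ.+ + 1) ℤ.* (+ 3 ℤ.* v ℤ.+ + 1))
    identity = ℤ-Solver.solve-∀

  pairWeight-odd : ∀ s t v n → s ℤ.+ t ≡ + 4 ℤ.* v ℤ.+ + 3 → pairWeight (s , t) ≢ 2 * n
  pairWeight-odd s t v n eq weight≡ with refl ← solve-sum s t eq =
    even≢odd (+ n) c (ℤ.*-cancelˡ-≡ (+ 2) _ _ (begin
      + 2 ℤ.* (+ 2 ℤ.* + n)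
        ≡⟨ cong (+ 2 ℤ.*_) (ℤ.pos-* 2 n) ⟨
      + 2 ℤ.* + (2 * n)
        ≡⟨ ℤ.pos-* 2 (2 * n) ⟨
      + (2 * (2 * n))
        ≡⟨ cong (λ w → + (2 * w)) weight≡ ⟨
      + (2 * pairWeight (s , t))
        ≡⟨ pairWeight-double s t ⟩
      s ℤ.* (+ 3 ℤ.* s ℤ.+ + 1) ℤ.+ + 3 ℤ.* (t ℤ.* (+ 3 ℤ.* t ℤ.+ + 1))
        ≡⟨ identity t v ⟩
      + 2 ℤ.* (+ 2 ℤ.* c ℤ.+ + 1) ∎))
    where
    open ≡-Reasoning
    c = + 12 ℤ.* v ℤ.* v ℤ.+ + 19 ℤ.* v ℤ.+ + 7 ℤ.- + 6 ℤ.* v ℤ.* t ℤ.- + 4 ℤ.* t ℤ.+ + 3 ℤ.* t ℤ.* t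

    identity : ∀ t v → let s = + 4 ℤ.* v ℤ.+ + 3 ℤ.- t in
      s ℤ.* (+ 3 ℤ.* s ℤ.+ + 1) ℤ.+ + 3 ℤ.* (t ℤ.* (+ 3 ℤ.* t ℤ.+ + 1)) ≡
      + 2 ℤ.* (+ 2 ℤ.* (+ 12 ℤ.* v ℤ.* v ℤ.+ + 19 ℤ.* v ℤ.+ + 7 ℤ.- + 6 ℤ.* v ℤ.* t
        ℤ.- + 4 ℤ.* t ℤ.+ + 3 ℤ.* t ℤ.* t) ℤ.+ + 1)
    identity = ℤ-Solver.solve-∀

  mod4 : ∀ z → ∃ λ q →
    (z ≡ + 2 ℤ.* (+ 2 ℤ.* q) ⊎ z ≡ + 2 ℤ.* (+ 2 ℤ.* q ℤ.+ + 1)) ⊎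
    z ≡ + 4 ℤ.* q ℤ.+ + 1 ⊎ z ≡ + 4 ℤ.* q ℤ.+ + 3
  mod4 z = q , split (z ℤ.%ℕ 4) (ℤ.n%ℕd<d z 4) (ℤ.a≡a%ℕn+[a/ℕn]*n z 4)
    where
    q = z ℤ./ℕ 4

    r0 : ∀ q → + 0 ℤ.+ q ℤ.* + 4 ≡ + 2 ℤ.* (+ 2 ℤ.* q)
    r0 = ℤ-Solver.solve-∀
    r1 : ∀ q → + 1 ℤ.+ q ℤ.* + 4 ≡ + 4 ℤ.* q ℤ.+ + 1
    r1 = ℤ-Solver.solve-∀
    r2 : ∀ q → + 2 ℤ.+ q ℤ.* + 4 ≡ + 2 ℤ.* (+ 2 ℤ.* q ℤ.+ + 1)
    r2 = ℤ-Solver.solve-∀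
    r3 : ∀ q → + 3 ℤ.+ q ℤ.* + 4 ≡ + 4 ℤ.* q ℤ.+ + 3
    r3 = ℤ-Solver.solve-∀

    split : ∀ r → r < 4 → z ≡ + r ℤ.+ q ℤ.* + 4 →
      (z ≡ + 2 ℤ.* (+ 2 ℤ.* q) ⊎ z ≡ + 2 ℤ.* (+ 2 ℤ.* q ℤ.+ + 1)) ⊎
      z ≡ + 4 ℤ.* q ℤ.+ + 1 ⊎ z ≡ + 4 ℤ.* q ℤ.+ + 3
    split 0 _ eq = inj₁ (inj₁ (trans eq (r0 q)))
    split 1 _ eq = inj₂ (inj₁ (trans eq (r1 q)))
    split 2 _ eq = inj₁ (inj₂ (trans eq (r2 q)))
    split 3 _ eq = inj₂ (inj₂ (trans eq (r3 q)))
    split (suc (suc (suc (suc r)))) r<4 = contradiction r<4 (ℕ.≤⇒≯ (ℕ.m≤m+n 4 r))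

  Associate : ℤ × ℤ → ℤ × Maybe ℤ → Set
  Associate (s , t) (r , nothing) = s ≡ r × t ≡ r
  Associate (s , t) (r , just v) = s ℤ.+ t ≡ + 4 ℤ.* v ℤ.+ + 1 × t ≡ v ℤ.- r

  R : (ℤ × ℤ) ⊎ (ℤ × Maybe ℤ) → (ℤ × ℤ) ⊎ (ℤ × Maybe ℤ) → Set
  R (inj₁ (s , t)) (inj₁ (s′ , t′)) = s ≢ t × s ℤ.+ t ≡ + 2 ℤ.* t′ × s′ ℤ.+ t′ ≡ + 2 ℤ.* t
  R (inj₁ x) (inj₂ y) = Associate x y
  R (inj₂ y) (inj₁ x) = Associate x y
  R (inj₂ _) (inj₂ _) = ⊥

  double-sum : ∀ t → t ℤ.+ t ≡ + 2 ℤ.* t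
  double-sum = ℤ-Solver.solve-∀

  sum-even≢sum-odd : ∀ {z} t′ v → z ≡ + 2 ℤ.* t′ → z ≢ + 4 ℤ.* v ℤ.+ + 1
  sum-even≢sum-odd t′ v even odd =
    even≢odd t′ (+ 2 ℤ.* v) (trans (sym even) (trans odd (regroup v)))
    where
    regroup : ∀ v → + 4 ℤ.* v ℤ.+ + 1 ≡ + 2 ℤ.* (+ 2 ℤ.* v) ℤ.+ + 1
    regroup = ℤ-Solver.solve-∀

  swapped-≢ : ∀ {s t s′ t′} → s ≢ t → s ℤ.+ t ≡ + 2 ℤ.* t′ → s′ ℤ.+ t′ ≡ + 2 ℤ.* t → s′ ≢ t′
  swapped-≢ {s} {t} {s′} s≢t eq eq′ refl
    with refl ← ℤ.*-cancelˡ-≡ (+ 2) s′ t (trans (sym (double-sum s′)) eq′) =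
    s≢t (+ℤ-cancelʳ t s t (trans eq (sym (double-sum t))))

  module _ (n : ℕ) where

    S : (ℤ × ℤ) ⊎ (ℤ × Maybe ℤ) → Set
    S = Sum.[ (λ x → pairWeight x ≡ 2 * n) , (λ y → mixedWeight 2 y ≡ n) ]

    symmetric : ∀ x y → R x y → R y x
    symmetric (inj₁ _) (inj₁ _) (s≢t , eq , eq′) = swapped-≢ s≢t eq eq′ , eq′ , eq
    symmetric (inj₁ _) (inj₂ _) Rxy = Rxy
    symmetric (inj₂ _) (inj₁ _) Rxy = Rxy

    irreflexive : ∀ x → ¬ R x x
    irreflexive (inj₁ (s , t)) (s≢t , eq , _) =
      s≢t (+ℤ-cancelʳ t s t (trans eq (sym (double-sum t))))

    functional : ∀ x y z → R x y → R x z → y ≡ z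
    functional (inj₁ (s , t)) (inj₁ (s₁ , t₁)) (inj₁ (s₂ , t₂)) (_ , eq₁ , eq₁′) (_ , eq₂ , eq₂′)
      with refl ← ℤ.*-cancelˡ-≡ (+ 2) t₁ t₂ (trans (sym eq₁) eq₂)
      with refl ← +ℤ-cancelʳ t₁ s₁ s₂ (trans eq₁′ (sym eq₂′)) = refl
    functional (inj₁ _) (inj₁ _) (inj₂ (_ , nothing)) (s≢t , _) (refl , refl) =
      contradiction refl s≢t
    functional (inj₁ _) (inj₁ (_ , t₁)) (inj₂ (_ , just v)) (_ , eq₁ , _) (eq₂ , _) =
      contradiction eq₂ (sum-even≢sum-odd t₁ v eq₁)
    functional (inj₁ _) (inj₂ (_ , nothing)) (inj₁ _) (refl , refl) (s≢t , _) =
      contradiction refl s≢t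
    functional (inj₁ _) (inj₂ (_ , nothing)) (inj₂ (_ , nothing)) (refl , _) (refl , _) = refl
    functional (inj₁ (s , _)) (inj₂ (_ , nothing)) (inj₂ (_ , just v)) (refl , refl) (eq₂ , _) =
      contradiction eq₂ (sum-even≢sum-odd s v (double-sum s))
    functional (inj₁ _) (inj₂ (_ , just v)) (inj₁ (_ , t₂)) (eq₁ , _) (_ , eq₂ , _) =
      contradiction eq₁ (sum-even≢sum-odd t₂ v eq₂)
    functional (inj₁ (s , _)) (inj₂ (_ , just v)) (inj₂ (_ , nothing)) (eq₁ , _) (refl , refl) =
      contradiction eq₁ (sum-even≢sum-odd s v (double-sum s))
    functional (inj₁ _) (inj₂ (r₁ , just v₁)) (inj₂ (r₂ , just v₂)) (eq₁ , eq₁′) (eq₂ , eq₂′)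
      with refl ← ℤ.*-cancelˡ-≡ (+ 4) v₁ v₂ (+ℤ-cancelʳ (+ 1) _ _ (trans (sym eq₁) eq₂))
      with refl ← ℤ.neg-injective (+ℤ-cancelˡ v₁ (ℤ.- r₁) (ℤ.- r₂) (trans (sym eq₁′) eq₂′)) = refl
    functional (inj₂ (_ , nothing)) (inj₁ _) (inj₁ _) (refl , refl) (refl , refl) = refl
    functional (inj₂ (_ , just v)) (inj₁ (s₁ , t₁)) (inj₁ (s₂ , _)) (eq₁ , refl) (eq₂ , refl)
      with refl ← +ℤ-cancelʳ t₁ s₁ s₂ (trans eq₁ (sym eq₂)) = refl

    partner : ∀ x → S x → ∃ λ y → S y × R x y
    partner (inj₁ (s , t)) Sx with s ℤ.≟ t
    ... | yes refl = inj₂ (s , nothing)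
          , ℕ.*-cancelˡ-≡ _ n 2 (trans (sym (pairWeight-diagonal s)) Sx) , refl , refl
    ... | no s≢t with mod4 (s ℤ.+ t)
    ... | q , inj₁ even = swapped (Sum.[ (λ eq → _ , eq) , (λ eq → _ , eq) ] even)
      where
      cancel : ∀ t t′ → + 2 ℤ.* t ℤ.- t′ ℤ.+ t′ ≡ + 2 ℤ.* t
      cancel = ℤ-Solver.solve-∀

      swapped : (∃ λ t′ → s ℤ.+ t ≡ + 2 ℤ.* t′) → ∃ λ y → S y × R (inj₁ (s , t)) y
      swapped (t′ , eq) = inj₁ (+ 2 ℤ.* t ℤ.- t′ , t′)
        , trans (sym (pairWeight-swap s t (+ 2 ℤ.* t ℤ.- t′) t′ eq (cancel t t′))) Sx
        , s≢t , eq , cancel t t′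
    ... | v , inj₂ (inj₁ eq) = inj₂ (v ℤ.- t , just v)
          , ℕ.*-cancelˡ-≡ _ n 2 (trans (sym (pairWeight-mixed s (v ℤ.- t) v
              (subst (λ u → s ℤ.+ u ≡ + 4 ℤ.* v ℤ.+ + 1) (reflect v t) eq)))
              (trans (cong (λ u → pairWeight (s , u)) (sym (reflect v t))) Sx))
          , eq , reflect v t
      where
      reflect : ∀ v t → t ≡ v ℤ.- (v ℤ.- t)
      reflect = ℤ-Solver.solve-∀
    ... | v , inj₂ (inj₂ eq) = contradiction Sx (pairWeight-odd s t v n eq)
    partner (inj₂ (r , nothing)) Sx = inj₁ (r , r)
      , trans (pairWeight-diagonal r) (cong (2 *_) Sx) , refl , refl
    partner (inj₂ (r , just v)) Sx = inj₁ (+ 4 ℤ.* v ℤ.+ + 1 ℤ.- t , t)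
      , trans (pairWeight-mixed (+ 4 ℤ.* v ℤ.+ + 1 ℤ.- t) r v (cancel v t)) (cong (2 *_) Sx)
      , cancel v t , refl
      where
      t = v ℤ.- r

      cancel : ∀ v t → + 4 ℤ.* v ℤ.+ + 1 ℤ.- t ℤ.+ t ≡ + 4 ℤ.* v ℤ.+ + 1
      cancel = ℤ-Solver.solve-∀

    matching : PerfectMatching S R
    matching = record
      { symmetric = λ {x} {y} → symmetric x y ; irreflexive = λ {x} _ → irreflexive x
      ; functional = λ {x} {y} {z} _ _ _ → functional x y z ; partner = λ {x} → partner x }

    dissection : (pentSeries 1 ⊛ pentSeries 3) (2 * n) ≡ (pentSeries 2 ⊛ squareSeries) n
    dissection = matching⇒≡ matching
      (Represents-⊛ (Represents-pent 1 (s≤s z≤n)) (Represents-pent 3 (s≤s z≤n)) (2 * n))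
      (Represents-⊛ (Represents-pent 2 (s≤s z≤n)) Represents-square n)

open PentagonalDissection using (mixedWeight; dissection)

b₃-even : ∀ n → b₃Series (2 * n) ≡ (pentSeries 1 ⊛ squareSeries) n
b₃-even = ⊛-cancelˡ P refl (λ n → begin
  (P ⊛ E) n
    ≡⟨ ⊛-comm P E n ⟩
  (E ⊛ P) n
    ≡⟨ ⊛-cong {f = E} (λ _ → refl) (λ i → sym (pent₂-even i)) n ⟩
  (E ⊛ (λ i → P₂ (2 * i))) n
    ≡⟨ ⊛-even b₃Series P₂ pent₂-odd n ⟨
  (b₃Series ⊛ P₂) (2 * n)
    ≡⟨ ⊛-cong {f = b₃Series} (λ _ → refl) (λ i → sym (pent²-swap i)) (2 * n) ⟩
  (b₃Series ⊛ (P ⊛ P)) (2 * n)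
    ≡⟨ ⊛-comm b₃Series (P ⊛ P) (2 * n) ⟩
  ((P ⊛ P) ⊛ b₃Series) (2 * n)
    ≡⟨ ⊛-assoc P P b₃Series (2 * n) ⟩
  (P ⊛ (P ⊛ b₃Series)) (2 * n)
    ≡⟨ ⊛-cong {f = P} (λ _ → refl) pent-b₃ (2 * n) ⟩
  (P ⊛ pentSeries 3) (2 * n)
    ≡⟨ dissection n ⟩
  (P₂ ⊛ squareSeries) n
    ≡⟨ ⊛-cong {g = squareSeries} (λ i → sym (pent²-swap i)) (λ _ → refl) n ⟩
  ((P ⊛ P) ⊛ squareSeries) n
    ≡⟨ ⊛-assoc P P squareSeries n ⟩
  (P ⊛ (P ⊛ squareSeries)) n ∎)
  where
  open ≡-Reasoning
  P = pentSeries 1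
  P₂ = pentSeries 2
  E : Series
  E i = b₃Series (2 * i)

-- Rotations of x² + 24y²

combine₃ : ∀ {l r a b c d e f} k k′ k″ → a ≡ b → c ≡ d → e ≡ f →
  l ℤ.- r ≡ k ℤ.* (a ℤ.- b) ℤ.+ k′ ℤ.* (c ℤ.- d) ℤ.+ k″ ℤ.* (e ℤ.- f) → l ≡ r
combine₃ {l} {r} k k′ k″ a≡b c≡d e≡f eq = ℤ.i-j≡0⇒i≡j l r
  (trans eq (cong₂ ℤ._+_ (cong₂ ℤ._+_ (vanish k a≡b) (vanish k′ c≡d)) (vanish k″ e≡f)))
  where
  vanish : ∀ {a b} k → a ≡ b → k ℤ.* (a ℤ.- b) ≡ + 0
  vanish k a≡b = trans (cong (k ℤ.*_) (ℤ.i≡j⇒i-j≡0 a≡b)) (ℤ.*-zeroʳ k)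

combine₂ : ∀ {l r a b c d} k k′ → a ≡ b → c ≡ d →
  l ℤ.- r ≡ k ℤ.* (a ℤ.- b) ℤ.+ k′ ℤ.* (c ℤ.- d) → l ≡ r
combine₂ k k′ a≡b c≡d eq =
  combine₃ k k′ (+ 0) a≡b c≡d (refl {x = + 0}) (trans eq (sym (ℤ.+-identityʳ _)))

record PrimeElement (P : ℤ) : Set where
  field
    nonZero : ℤ.NonZero P
    nonUnit : ¬ P ∣ℤ + 1
    euclid  : ∀ a b → P ∣ℤ a ℤ.* b → P ∣ℤ a ⊎ P ∣ℤ b

  euclid-square : ∀ a → P ∣ℤ a ℤ.* a → P ∣ℤ a
  euclid-square a p∣a² = Sum.[ (λ h → h) , (λ h → h) ] (euclid a a p∣a²)

prime⇒primeElement : ∀ {p} → Prime p → PrimeElement (+ p)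
prime⇒primeElement {p} prime-p = record
  { nonZero = prime⇒nonZero prime-p
  ; nonUnit = λ p∣1 → ¬prime[1] (subst Prime (∣1⇒≡1 (ℤ∣.∣⇒∣ᵤ p∣1)) prime-p)
  ; euclid = λ a b p∣ab → Sum.map ℤ∣.∣ᵤ⇒∣ ℤ∣.∣ᵤ⇒∣
      (euclidsLemma ∣ a ∣ ∣ b ∣ prime-p (subst (p ∣_) (ℤ.abs-* a b) (ℤ∣.∣⇒∣ᵤ p∣ab)))
  }

-- A number A + B√-216 of norm P², with P ∤ B and A ≡ P (mod 6).
record NormSquare (P : ℤ) : Set where
  field
    A B D : ℤ
    A≡P-6D : A ≡ P ℤ.- + 6 ℤ.* D
    norm : A ℤ.* A ℤ.+ + 216 ℤ.* (B ℤ.* B) ≡ P ℤ.* P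
    P∤B : ¬ P ∣ℤ B

module PrimeTo6 {P : ℤ} (primeP : PrimeElement P)
  {m c : ℤ} (c*P≡ : c ℤ.* P ≡ + 24 ℤ.* m ℤ.+ + 1) where

  open PrimeElement primeP

  private instance
    P-nonZero : ℤ.NonZero P
    P-nonZero = nonZero

  cancel24 : ∀ z → P ∣ℤ + 24 ℤ.* z → P ∣ℤ z
  cancel24 z (dividesℤ q eq) = dividesℤ (c ℤ.* z ℤ.- m ℤ.* q)
    (combine₂ (ℤ.- z) (ℤ.- m) c*P≡ eq (identity z q m c P))
    where
    identity : ∀ z q m c P → z ℤ.- (c ℤ.* z ℤ.- m ℤ.* q) ℤ.* P ≡
      ℤ.- z ℤ.* (c ℤ.* P ℤ.- (+ 24 ℤ.* m ℤ.+ + 1)) ℤ.+ ℤ.- m ℤ.* (+ 24 ℤ.* z ℤ.- q ℤ.* P)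
    identity = ℤ-Solver.solve-∀

  cancel-factor : ∀ k l z → k ℤ.* l ≡ + 24 → P ∣ℤ k ℤ.* z → P ∣ℤ z
  cancel-factor k l z kl≡24 p∣kz = cancel24 z
    (subst (P ∣ℤ_) (trans (regroup k l z) (cong (ℤ._* z) kl≡24)) (ℤ∣.∣n⇒∣m*n l p∣kz))
    where
    regroup : ∀ k l z → l ℤ.* (k ℤ.* z) ≡ k ℤ.* l ℤ.* z
    regroup = ℤ-Solver.solve-∀

  cancel54 : ∀ z → P ∣ℤ + 54 ℤ.* z → P ∣ℤ z
  cancel54 z p∣54z = cancel24 z (cancel24 (+ 24 ℤ.* z) (cancel24 (+ 24 ℤ.* (+ 24 ℤ.* z))
    (subst (P ∣ℤ_) (regroup z) (ℤ∣.∣n⇒∣m*n (+ 256) p∣54z))))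
    where
    regroup : ∀ z → + 256 ℤ.* (+ 54 ℤ.* z) ≡ + 24 ℤ.* (+ 24 ℤ.* (+ 24 ℤ.* z))
    regroup = ℤ-Solver.solve-∀

  -- The square of u√a + v√(-3b).
  form⇒NormSquare : ∀ a b u v → a ℤ.* (+ 3 ℤ.* b) ≡ + 54 →
    a ℤ.* (u ℤ.* u) ℤ.+ + 3 ℤ.* b ℤ.* (v ℤ.* v) ≡ P → NormSquare P
  form⇒NormSquare a b u v 3ab≡54 form≡P = record
    { A = a ℤ.* (u ℤ.* u) ℤ.- + 3 ℤ.* b ℤ.* (v ℤ.* v)
    ; B = u ℤ.* v
    ; D = b ℤ.* (v ℤ.* v)
    ; A≡P-6D = trans (identity-A (a ℤ.* (u ℤ.* u)) b (v ℤ.* v))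
        (cong (ℤ._- + 6 ℤ.* (b ℤ.* (v ℤ.* v))) form≡P)
    ; norm = trans (cong (λ n → (a ℤ.* (u ℤ.* u) ℤ.- + 3 ℤ.* b ℤ.* (v ℤ.* v)) ℤ.*
          (a ℤ.* (u ℤ.* u) ℤ.- + 3 ℤ.* b ℤ.* (v ℤ.* v)) ℤ.+
          + 4 ℤ.* n ℤ.* (u ℤ.* v ℤ.* (u ℤ.* v))) (sym 3ab≡54))
        (trans (cong (λ n → (a ℤ.* (u ℤ.* u) ℤ.- + 3 ℤ.* b ℤ.* (v ℤ.* v)) ℤ.*
          (a ℤ.* (u ℤ.* u) ℤ.- + 3 ℤ.* b ℤ.* (v ℤ.* v)) ℤ.+
          + 4 ℤ.* (a ℤ.* (+ 3 ℤ.* b)) ℤ.* n) (square-product u v))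
        (trans (identity-norm a (+ 3 ℤ.* b) (u ℤ.* u) (v ℤ.* v)) (cong (λ z → z ℤ.* z) form≡P)))
    ; P∤B = λ p∣uv → Sum.[ p∤u , p∤v ] (euclid u v p∣uv)
    }
    where
    identity-A : ∀ x b y → x ℤ.- + 3 ℤ.* b ℤ.* y ≡ x ℤ.+ + 3 ℤ.* b ℤ.* y ℤ.- + 6 ℤ.* (b ℤ.* y)
    identity-A = ℤ-Solver.solve-∀

    square-product : ∀ u v → u ℤ.* v ℤ.* (u ℤ.* v) ≡ u ℤ.* u ℤ.* (v ℤ.* v)
    square-product = ℤ-Solver.solve-∀

    identity-norm : ∀ a b x y →
      (a ℤ.* x ℤ.- b ℤ.* y) ℤ.* (a ℤ.* x ℤ.- b ℤ.* y) ℤ.+ + 4 ℤ.* (a ℤ.* b) ℤ.* (x ℤ.* y) ≡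
      (a ℤ.* x ℤ.+ b ℤ.* y) ℤ.* (a ℤ.* x ℤ.+ b ℤ.* y)
    identity-norm = ℤ-Solver.solve-∀

    cancel-a : ∀ z → P ∣ℤ a ℤ.* z → P ∣ℤ z
    cancel-a z p∣az = cancel54 z (subst (P ∣ℤ_)
      (trans (regroup a (+ 3 ℤ.* b) z) (cong (ℤ._* z) 3ab≡54)) (ℤ∣.∣n⇒∣m*n (+ 3 ℤ.* b) p∣az))
      where
      regroup : ∀ a b z → b ℤ.* (a ℤ.* z) ≡ a ℤ.* b ℤ.* z
      regroup = ℤ-Solver.solve-∀

    cancel-3b : ∀ z → P ∣ℤ + 3 ℤ.* b ℤ.* z → P ∣ℤ z
    cancel-3b z p∣bz = cancel54 z (subst (P ∣ℤ_)
      (trans (sym (ℤ.*-assoc a (+ 3 ℤ.* b) z)) (cong (ℤ._* z) 3ab≡54)) (ℤ∣.∣n⇒∣m*n a p∣bz))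

    p∣form : P ∣ℤ a ℤ.* (u ℤ.* u) ℤ.+ + 3 ℤ.* b ℤ.* (v ℤ.* v)
    p∣form = subst (P ∣ℤ_) (sym form≡P) ℤ∣.∣-refl

    not-both : P ∣ℤ u → P ∣ℤ v → ⊥
    not-both (dividesℤ u₁ u≡) (dividesℤ v₁ v≡) = nonUnit
      (dividesℤ form₁ (ℤ.*-cancelʳ-≡ (+ 1) (form₁ ℤ.* P) P (begin
        + 1 ℤ.* P
          ≡⟨ ℤ.*-identityˡ P ⟩
        P
          ≡⟨ form≡P ⟨
        a ℤ.* (u ℤ.* u) ℤ.+ + 3 ℤ.* b ℤ.* (v ℤ.* v)
          ≡⟨ cong₂ (λ x y → a ℤ.* (x ℤ.* x) ℤ.+ + 3 ℤ.* b ℤ.* (y ℤ.* y)) u≡ v≡ ⟩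
        a ℤ.* (u₁ ℤ.* P ℤ.* (u₁ ℤ.* P)) ℤ.+ + 3 ℤ.* b ℤ.* (v₁ ℤ.* P ℤ.* (v₁ ℤ.* P))
          ≡⟨ factor a (+ 3 ℤ.* b) u₁ v₁ P ⟩
        form₁ ℤ.* P ℤ.* P ∎)))
      where
      open ≡-Reasoning
      form₁ = a ℤ.* (u₁ ℤ.* u₁) ℤ.+ + 3 ℤ.* b ℤ.* (v₁ ℤ.* v₁)

      factor : ∀ a b u v P → a ℤ.* (u ℤ.* P ℤ.* (u ℤ.* P)) ℤ.+ b ℤ.* (v ℤ.* P ℤ.* (v ℤ.* P)) ≡
        (a ℤ.* (u ℤ.* u) ℤ.+ b ℤ.* (v ℤ.* v)) ℤ.* P ℤ.* P
      factor = ℤ-Solver.solve-∀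

    p∤v : ¬ P ∣ℤ v
    p∤v p∣v = not-both (euclid-square u (cancel-a (u ℤ.* u)
      (ℤ∣.∣m+n∣n⇒∣m p∣form (ℤ∣.∣n⇒∣m*n (+ 3 ℤ.* b) (ℤ∣.∣n⇒∣m*n v p∣v))))) p∣v

    p∤u : ¬ P ∣ℤ u
    p∤u p∣u = not-both p∣u (euclid-square v (cancel-3b (v ℤ.* v)
      (ℤ∣.∣m+n∣m⇒∣n p∣form (ℤ∣.∣n⇒∣m*n a (ℤ∣.∣n⇒∣m*n u p∣u)))))

  form₁⇒NormSquare : ∀ x y → x ℤ.* x ℤ.+ + 216 ℤ.* (y ℤ.* y) ≡ + 1 ℤ.* P → NormSquare P
  form₁⇒NormSquare x y eq = form⇒NormSquare (+ 1) (+ 18) x (+ 2 ℤ.* y) refl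
    (trans (identity x y) (trans eq (ℤ.*-identityˡ P)))
    where
    identity : ∀ x y → + 1 ℤ.* (x ℤ.* x) ℤ.+ + 54 ℤ.* (+ 2 ℤ.* y ℤ.* (+ 2 ℤ.* y)) ≡
      x ℤ.* x ℤ.+ + 216 ℤ.* (y ℤ.* y)
    identity = ℤ-Solver.solve-∀

  form₄⇒NormSquare : ∀ x y → x ℤ.* x ℤ.+ + 216 ℤ.* (y ℤ.* y) ≡ + 4 ℤ.* P → NormSquare P
  form₄⇒NormSquare x y eq = halve even-x
    where
    even-x : + 2 ∣ℤ x
    even-x = PrimeElement.euclid-square (prime⇒primeElement prime[2]) x (ℤ∣.∣m+n∣n⇒∣m
      (subst (+ 2 ∣ℤ_) (sym eq) (ℤ∣.∣m⇒∣m*n P (dividesℤ (+ 2) refl)))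
      (ℤ∣.∣m⇒∣m*n (y ℤ.* y) (dividesℤ (+ 108) refl)))

    identity : ∀ x y → + 4 ℤ.* (+ 1 ℤ.* (x ℤ.* x) ℤ.+ + 54 ℤ.* (y ℤ.* y)) ≡
      x ℤ.* + 2 ℤ.* (x ℤ.* + 2) ℤ.+ + 216 ℤ.* (y ℤ.* y)
    identity = ℤ-Solver.solve-∀

    halve : + 2 ∣ℤ x → NormSquare P
    halve (dividesℤ x₁ refl) = form⇒NormSquare (+ 1) (+ 18) x₁ y refl
      (ℤ.*-cancelˡ-≡ (+ 4) _ _ (trans (identity x₁ y) eq))

  form₈⇒NormSquare : ∀ x y → x ℤ.* x ℤ.+ + 216 ℤ.* (y ℤ.* y) ≡ + 8 ℤ.* P → NormSquare P
  form₈⇒NormSquare x y eq₈ = quarter quarter-x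
    where
    divide4 : ∀ x y P → x ℤ.* + 2 ℤ.* (x ℤ.* + 2) ℤ.+ + 216 ℤ.* (y ℤ.* y) ≡ + 8 ℤ.* P →
      x ℤ.* x ℤ.+ + 54 ℤ.* (y ℤ.* y) ≡ + 2 ℤ.* P
    divide4 x y P eq = ℤ.*-cancelˡ-≡ (+ 4) _ _ (trans (expand x y) (trans eq (regroup P)))
      where
      expand : ∀ x y → + 4 ℤ.* (x ℤ.* x ℤ.+ + 54 ℤ.* (y ℤ.* y)) ≡
        x ℤ.* + 2 ℤ.* (x ℤ.* + 2) ℤ.+ + 216 ℤ.* (y ℤ.* y)
      expand = ℤ-Solver.solve-∀

      regroup : ∀ P → + 8 ℤ.* P ≡ + 4 ℤ.* (+ 2 ℤ.* P)
      regroup = ℤ-Solver.solve-∀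

    quarter-x : ∃ λ x₂ → x ≡ x₂ ℤ.* + 2 ℤ.* + 2
    quarter-x with PrimeElement.euclid-square (prime⇒primeElement prime[2]) x (ℤ∣.∣m+n∣n⇒∣m
      (subst (+ 2 ∣ℤ_) (sym eq₈) (ℤ∣.∣m⇒∣m*n P (dividesℤ (+ 4) refl)))
      (ℤ∣.∣m⇒∣m*n (y ℤ.* y) (dividesℤ (+ 108) refl)))
    ... | dividesℤ x₁ refl with PrimeElement.euclid-square (prime⇒primeElement prime[2]) x₁ (ℤ∣.∣m+n∣n⇒∣m
      (subst (+ 2 ∣ℤ_) (sym (divide4 x₁ y P eq₈)) (ℤ∣.∣m⇒∣m*n P ℤ∣.∣-refl))
      (ℤ∣.∣m⇒∣m*n (y ℤ.* y) (dividesℤ (+ 27) refl)))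
    ... | dividesℤ x₂ refl = x₂ , refl

    identity : ∀ x y → + 8 ℤ.* (+ 2 ℤ.* (x ℤ.* x) ℤ.+ + 27 ℤ.* (y ℤ.* y)) ≡
      x ℤ.* + 2 ℤ.* + 2 ℤ.* (x ℤ.* + 2 ℤ.* + 2) ℤ.+ + 216 ℤ.* (y ℤ.* y)
    identity = ℤ-Solver.solve-∀

    quarter : (∃ λ x₂ → x ≡ x₂ ℤ.* + 2 ℤ.* + 2) → NormSquare P
    quarter (x₂ , refl) = form⇒NormSquare (+ 2) (+ 9) x₂ y refl
      (ℤ.*-cancelˡ-≡ (+ 8) _ _ (trans (identity x₂ y) eq₈))

brahmagupta : ∀ A B x y →
  (A ℤ.* x ℤ.- + 72 ℤ.* (B ℤ.* y)) ℤ.* (A ℤ.* x ℤ.- + 72 ℤ.* (B ℤ.* y)) ℤ.+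
    + 24 ℤ.* ((A ℤ.* y ℤ.+ + 3 ℤ.* (B ℤ.* x)) ℤ.* (A ℤ.* y ℤ.+ + 3 ℤ.* (B ℤ.* x))) ≡
  (A ℤ.* A ℤ.+ + 216 ℤ.* (B ℤ.* B)) ℤ.* (x ℤ.* x ℤ.+ + 24 ℤ.* (y ℤ.* y))
brahmagupta = ℤ-Solver.solve-∀

X Y : ℤ → ℤ
X r = + 6 ℤ.* r ℤ.+ + 1
Y k = + 3 ℤ.* k ℤ.+ + 1

pent-norm : ∀ r → + (24 * (1 * pent r) + 1) ≡ X r ℤ.* X r
pent-norm r = begin
  + (24 * (1 * pent r) + 1)
    ≡⟨ cong (λ n → + (n + 1)) (regroup (pent r)) ⟩
  + (12 * (2 * pent r)) ℤ.+ + 1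
    ≡⟨ cong (ℤ._+ + 1) (trans (ℤ.pos-* 12 (2 * pent r)) (cong (+ 12 ℤ.*_) (pent-double r))) ⟩
  + 12 ℤ.* (r ℤ.* (+ 3 ℤ.* r ℤ.+ + 1)) ℤ.+ + 1
    ≡⟨ square r ⟩
  X r ℤ.* X r ∎
  where
  open ≡-Reasoning

  regroup : ∀ n → 24 * (1 * n) ≡ 12 * (2 * n)
  regroup = ℕ-Solver.solve-∀

  square : ∀ r → + 12 ℤ.* (r ℤ.* (+ 3 ℤ.* r ℤ.+ + 1)) ℤ.+ + 1 ≡
    (+ 6 ℤ.* r ℤ.+ + 1) ℤ.* (+ 6 ℤ.* r ℤ.+ + 1)
  square = ℤ-Solver.solve-∀

mixedWeight-nothing : ∀ r → + (24 * mixedWeight 1 (r , nothing) + 1) ≡ X r ℤ.* X r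
mixedWeight-nothing r =
  trans (cong (λ n → + (24 * n + 1)) (ℕ.+-identityʳ (1 * pent r))) (pent-norm r)

mixedWeight-just : ∀ r k →
  + (24 * mixedWeight 1 (r , just k) + 1) ≡ X r ℤ.* X r ℤ.+ + 24 ℤ.* (Y k ℤ.* Y k)
mixedWeight-just r k = begin
  + (24 * (1 * pent r + squareWeight (just k)) + 1)
    ≡⟨ cong +_ (regroup (1 * pent r) (squareWeight (just k))) ⟩
  + (24 * (1 * pent r) + 1) ℤ.+ + (24 * squareWeight (just k))
    ≡⟨ cong₂ ℤ._+_ (pent-norm r)
         (trans (ℤ.pos-* 24 (squareWeight (just k))) (cong (+ 24 ℤ.*_) (∣z∣²≡z² (Y k)))) ⟩
  X r ℤ.* X r ℤ.+ + 24 ℤ.* (Y k ℤ.* Y k) ∎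
  where
  open ≡-Reasoning

  regroup : ∀ x y → 24 * (x + y) + 1 ≡ 24 * x + 1 + 24 * y
  regroup = ℕ-Solver.solve-∀

X-injective : ∀ r r′ → X r ≡ X r′ → r ≡ r′
X-injective r r′ eq = ℤ.*-cancelˡ-≡ (+ 6) r r′ (+ℤ-cancelʳ (+ 1) _ _ eq)

Y-injective : ∀ k k′ → Y k ≡ Y k′ → k ≡ k′
Y-injective k k′ eq = ℤ.*-cancelˡ-≡ (+ 3) k k′ (+ℤ-cancelʳ (+ 1) _ _ eq)

X-+ : ∀ r z → X (r ℤ.+ z) ≡ X r ℤ.+ + 6 ℤ.* z
X-+ = expand
  where
  expand : ∀ r z → + 6 ℤ.* (r ℤ.+ z) ℤ.+ + 1 ≡ + 6 ℤ.* r ℤ.+ + 1 ℤ.+ + 6 ℤ.* z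
  expand = ℤ-Solver.solve-∀

Y-+ : ∀ k w → Y (k ℤ.+ w) ≡ Y k ℤ.+ + 3 ℤ.* w
Y-+ = expand
  where
  expand : ∀ k w → + 3 ℤ.* (k ℤ.+ w) ℤ.+ + 1 ≡ + 3 ℤ.* k ℤ.+ + 1 ℤ.+ + 3 ℤ.* w
  expand = ℤ-Solver.solve-∀

module RotationMatching {P : ℤ} (primeP : PrimeElement P)
  {m c : ℤ} (c*P≡ : c ℤ.* P ≡ + 24 ℤ.* m ℤ.+ + 1) (normSquare : NormSquare P) where

  open PrimeElement primeP
  open PrimeTo6 primeP {m} {c} c*P≡ using (cancel54; cancel-factor)
  open NormSquare normSquare using (A; D; A≡P-6D; P∤B) renaming (B to B₀; norm to norm₀)

  private instance
    P-nonZero : ℤ.NonZero P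
    P-nonZero = nonZero

  Rotation : (B x y x′ y′ : ℤ) → Set
  Rotation B x y x′ y′ =
    P ℤ.* x′ ≡ A ℤ.* x ℤ.- + 72 ℤ.* (B ℤ.* y) × P ℤ.* y′ ≡ A ℤ.* y ℤ.+ + 3 ℤ.* (B ℤ.* x)

  Rotation-unique : ∀ B {x y x₁ y₁ x₂ y₂} → Rotation B x y x₁ y₁ → Rotation B x y x₂ y₂ →
    x₁ ≡ x₂ × y₁ ≡ y₂
  Rotation-unique B (ex₁ , ey₁) (ex₂ , ey₂) =
    ℤ.*-cancelˡ-≡ P _ _ (trans ex₁ (sym ex₂)) , ℤ.*-cancelˡ-≡ P _ _ (trans ey₁ (sym ey₂))

  P∤A : ¬ P ∣ℤ A
  P∤A (dividesℤ q A≡qP) = P∤B (euclid-square B₀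
    (cancel-factor (+ 4) (+ 6) (B₀ ℤ.* B₀) refl
      (cancel54 (+ 4 ℤ.* (B₀ ℤ.* B₀))
        (dividesℤ (P ℤ.- A ℤ.* q)
          (combine₂ (+ 1) (ℤ.- A) norm₀ A≡qP (identity A B₀ q P))))))
    where
    identity : ∀ A B q P → + 54 ℤ.* (+ 4 ℤ.* (B ℤ.* B)) ℤ.- (P ℤ.- A ℤ.* q) ℤ.* P ≡
      + 1 ℤ.* (A ℤ.* A ℤ.+ + 216 ℤ.* (B ℤ.* B) ℤ.- P ℤ.* P) ℤ.+ ℤ.- A ℤ.* (A ℤ.- q ℤ.* P)
    identity = ℤ-Solver.solve-∀

  module _ (B : ℤ) (norm : A ℤ.* A ℤ.+ + 216 ℤ.* (B ℤ.* B) ≡ P ℤ.* P) where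

    Rotation-inverse : ∀ {x y x′ y′} → Rotation B x y x′ y′ → Rotation (ℤ.- B) x′ y′ x y
    Rotation-inverse {x} {y} {x′} {y′} (eqx , eqy) =
      ℤ.*-cancelˡ-≡ P _ _ (combine₃ (ℤ.- x) (ℤ.- A) (ℤ.- (+ 72 ℤ.* B)) norm eqx eqy
        (identity-x A B P x y x′ y′)) ,
      ℤ.*-cancelˡ-≡ P _ _ (combine₃ (ℤ.- y) (+ 3 ℤ.* B) (ℤ.- A) norm eqx eqy
        (identity-y A B P x y x′ y′))
      where
      identity-x : ∀ A B P x y x′ y′ →
        P ℤ.* (P ℤ.* x) ℤ.- P ℤ.* (A ℤ.* x′ ℤ.- + 72 ℤ.* (ℤ.- B ℤ.* y′)) ≡
        ℤ.- x ℤ.* (A ℤ.* A ℤ.+ + 216 ℤ.* (B ℤ.* B) ℤ.- P ℤ.* P)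
        ℤ.+ ℤ.- A ℤ.* (P ℤ.* x′ ℤ.- (A ℤ.* x ℤ.- + 72 ℤ.* (B ℤ.* y)))
        ℤ.+ ℤ.- (+ 72 ℤ.* B) ℤ.* (P ℤ.* y′ ℤ.- (A ℤ.* y ℤ.+ + 3 ℤ.* (B ℤ.* x)))
      identity-x = ℤ-Solver.solve-∀

      identity-y : ∀ A B P x y x′ y′ →
        P ℤ.* (P ℤ.* y) ℤ.- P ℤ.* (A ℤ.* y′ ℤ.+ + 3 ℤ.* (ℤ.- B ℤ.* x′)) ≡
        ℤ.- y ℤ.* (A ℤ.* A ℤ.+ + 216 ℤ.* (B ℤ.* B) ℤ.- P ℤ.* P)
        ℤ.+ + 3 ℤ.* B ℤ.* (P ℤ.* x′ ℤ.- (A ℤ.* x ℤ.- + 72 ℤ.* (B ℤ.* y)))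
        ℤ.+ ℤ.- A ℤ.* (P ℤ.* y′ ℤ.- (A ℤ.* y ℤ.+ + 3 ℤ.* (B ℤ.* x)))
      identity-y = ℤ-Solver.solve-∀

    Rotation-exists : ∀ r k → P ∣ℤ A ℤ.* Y k ℤ.+ + 3 ℤ.* (B ℤ.* X r) →
      ∃ λ r′ → ∃ λ k′ → Rotation B (X r) (Y k) (X r′) (Y k′) ×
        X r′ ℤ.* X r′ ℤ.+ + 24 ℤ.* (Y k′ ℤ.* Y k′) ≡ X r ℤ.* X r ℤ.+ + 24 ℤ.* (Y k ℤ.* Y k)
    Rotation-exists r k P∣b = result (X r) (Y k) refl refl P∣b (P∣a (X r) (Y k) P∣b)
      where
      norm-image : ∀ x y → (A ℤ.* x ℤ.- + 72 ℤ.* (B ℤ.* y)) ℤ.* (A ℤ.* x ℤ.- + 72 ℤ.* (B ℤ.* y)) ℤ.+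
        + 24 ℤ.* ((A ℤ.* y ℤ.+ + 3 ℤ.* (B ℤ.* x)) ℤ.* (A ℤ.* y ℤ.+ + 3 ℤ.* (B ℤ.* x))) ≡
        P ℤ.* P ℤ.* (x ℤ.* x ℤ.+ + 24 ℤ.* (y ℤ.* y))
      norm-image x y = trans (brahmagupta A B x y)
        (cong (λ n → n ℤ.* (x ℤ.* x ℤ.+ + 24 ℤ.* (y ℤ.* y))) norm)

      P∣a′ : ∀ a b N → a ℤ.* a ℤ.+ + 24 ℤ.* (b ℤ.* b) ≡ P ℤ.* P ℤ.* N → P ∣ℤ b → P ∣ℤ a
      P∣a′ a b N eq P∣b = euclid-square a (ℤ∣.∣m+n∣n⇒∣m
        (subst (P ∣ℤ_) (sym eq) (ℤ∣.∣m⇒∣m*n N (ℤ∣.∣m⇒∣m*n P ℤ∣.∣-refl)))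
        (ℤ∣.∣n⇒∣m*n (+ 24) (ℤ∣.∣n⇒∣m*n b P∣b)))

      P∣a : ∀ x y → P ∣ℤ A ℤ.* y ℤ.+ + 3 ℤ.* (B ℤ.* x) → P ∣ℤ A ℤ.* x ℤ.- + 72 ℤ.* (B ℤ.* y)
      P∣a x y = P∣a′ (A ℤ.* x ℤ.- + 72 ℤ.* (B ℤ.* y)) (A ℤ.* y ℤ.+ + 3 ℤ.* (B ℤ.* x))
        (x ℤ.* x ℤ.+ + 24 ℤ.* (y ℤ.* y)) (norm-image x y)

      norm-quotient : ∀ a b N x′ y′ → a ℤ.* a ℤ.+ + 24 ℤ.* (b ℤ.* b) ≡ P ℤ.* P ℤ.* N →
        a ≡ x′ ℤ.* P → b ≡ y′ ℤ.* P → x′ ℤ.* x′ ℤ.+ + 24 ℤ.* (y′ ℤ.* y′) ≡ N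
      norm-quotient _ _ N x′ y′ eq refl refl = ℤ.*-cancelˡ-≡ P _ _ (ℤ.*-cancelˡ-≡ P _ _
        (trans (regroup x′ y′ P) (trans eq (ℤ.*-assoc P P N))))
        where
        regroup : ∀ x y P → P ℤ.* (P ℤ.* (x ℤ.* x ℤ.+ + 24 ℤ.* (y ℤ.* y))) ≡
          x ℤ.* P ℤ.* (x ℤ.* P) ℤ.+ + 24 ℤ.* (y ℤ.* P ℤ.* (y ℤ.* P))
        regroup = ℤ-Solver.solve-∀

      -- As c P = 24m + 1, multiplication by c inverts P in the congruences
      -- P (x′ - x) ≡ 0 (mod 6) and P (y′ - y) ≡ 0 (mod 3).
      congruent-x : ∀ x y x′ → A ℤ.* x ℤ.- + 72 ℤ.* (B ℤ.* y) ≡ x′ ℤ.* P →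
        ∃ λ z → x ℤ.+ + 6 ℤ.* z ≡ x′
      congruent-x x y x′ eq = _ , combine₃ c (ℤ.- (c ℤ.* x)) (x′ ℤ.- x) eq A≡P-6D c*P≡
        (identity A B D P c m x y x′)
        where
        identity : ∀ A B D P c m x y x′ →
          x ℤ.+ + 6 ℤ.* (c ℤ.* (ℤ.- (D ℤ.* x) ℤ.- + 12 ℤ.* (B ℤ.* y))
            ℤ.- + 4 ℤ.* (m ℤ.* (x′ ℤ.- x))) ℤ.- x′ ≡
          c ℤ.* (A ℤ.* x ℤ.- + 72 ℤ.* (B ℤ.* y) ℤ.- x′ ℤ.* P)
          ℤ.+ ℤ.- (c ℤ.* x) ℤ.* (A ℤ.- (P ℤ.- + 6 ℤ.* D))
          ℤ.+ (x′ ℤ.- x) ℤ.* (c ℤ.* P ℤ.- (+ 24 ℤ.* m ℤ.+ + 1))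
        identity = ℤ-Solver.solve-∀

      congruent-y : ∀ x y y′ → A ℤ.* y ℤ.+ + 3 ℤ.* (B ℤ.* x) ≡ y′ ℤ.* P →
        ∃ λ w → y ℤ.+ + 3 ℤ.* w ≡ y′
      congruent-y x y y′ eq = _ , combine₃ c (ℤ.- (c ℤ.* y)) (y′ ℤ.- y) eq A≡P-6D c*P≡
        (identity A B D P c m x y y′)
        where
        identity : ∀ A B D P c m x y y′ →
          y ℤ.+ + 3 ℤ.* (c ℤ.* (B ℤ.* x ℤ.- + 2 ℤ.* (D ℤ.* y))
            ℤ.- + 8 ℤ.* (m ℤ.* (y′ ℤ.- y))) ℤ.- y′ ≡
          c ℤ.* (A ℤ.* y ℤ.+ + 3 ℤ.* (B ℤ.* x) ℤ.- y′ ℤ.* P)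
          ℤ.+ ℤ.- (c ℤ.* y) ℤ.* (A ℤ.- (P ℤ.- + 6 ℤ.* D))
          ℤ.+ (y′ ℤ.- y) ℤ.* (c ℤ.* P ℤ.- (+ 24 ℤ.* m ℤ.+ + 1))
        identity = ℤ-Solver.solve-∀

      result : ∀ x y → x ≡ X r → y ≡ Y k → P ∣ℤ A ℤ.* y ℤ.+ + 3 ℤ.* (B ℤ.* x) →
        P ∣ℤ A ℤ.* x ℤ.- + 72 ℤ.* (B ℤ.* y) →
        ∃ λ r′ → ∃ λ k′ → Rotation B x y (X r′) (Y k′) ×
          X r′ ℤ.* X r′ ℤ.+ + 24 ℤ.* (Y k′ ℤ.* Y k′) ≡ x ℤ.* x ℤ.+ + 24 ℤ.* (y ℤ.* y)
      result x y x≡ y≡ (dividesℤ y′ b≡) (dividesℤ x′ a≡) =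
        assemble (congruent-x x y x′ a≡) (congruent-y x y y′ b≡)
        where
        assemble : (∃ λ z → x ℤ.+ + 6 ℤ.* z ≡ x′) → (∃ λ w → y ℤ.+ + 3 ℤ.* w ≡ y′) →
          ∃ λ r′ → ∃ λ k′ → Rotation B x y (X r′) (Y k′) ×
            X r′ ℤ.* X r′ ℤ.+ + 24 ℤ.* (Y k′ ℤ.* Y k′) ≡ x ℤ.* x ℤ.+ + 24 ℤ.* (y ℤ.* y)
        assemble (z , x+6z≡x′) (w , y+3w≡y′) = r ℤ.+ z , k ℤ.+ w ,
          (trans (cong (P ℤ.*_) Xr′≡x′) (trans (ℤ.*-comm P x′) (sym a≡)) ,
           trans (cong (P ℤ.*_) Yk′≡y′) (trans (ℤ.*-comm P y′) (sym b≡))) ,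
          trans (cong₂ (λ u v → u ℤ.* u ℤ.+ + 24 ℤ.* (v ℤ.* v)) Xr′≡x′ Yk′≡y′)
            (norm-quotient (A ℤ.* x ℤ.- + 72 ℤ.* (B ℤ.* y)) (A ℤ.* y ℤ.+ + 3 ℤ.* (B ℤ.* x))
              (x ℤ.* x ℤ.+ + 24 ℤ.* (y ℤ.* y)) x′ y′ (norm-image x y) a≡ b≡)
          where
          Xr′≡x′ : X (r ℤ.+ z) ≡ x′
          Xr′≡x′ = trans (X-+ r z) (trans (cong (λ u → u ℤ.+ + 6 ℤ.* z) (sym x≡)) x+6z≡x′)

          Yk′≡y′ : Y (k ℤ.+ w) ≡ y′
          Yk′≡y′ = trans (Y-+ k w) (trans (cong (λ u → u ℤ.+ + 3 ℤ.* w) (sym y≡)) y+3w≡y′)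

  norm₀⁻ : A ℤ.* A ℤ.+ + 216 ℤ.* (ℤ.- B₀ ℤ.* ℤ.- B₀) ≡ P ℤ.* P
  norm₀⁻ = trans (cong (λ z → A ℤ.* A ℤ.+ + 216 ℤ.* z) (neg-square B₀)) norm₀
    where
    neg-square : ∀ B → ℤ.- B ℤ.* ℤ.- B ≡ B ℤ.* B
    neg-square = ℤ-Solver.solve-∀

  Neighbour : (x y x′ y′ : ℤ) → Set
  Neighbour x y x′ y′ = Rotation B₀ x y x′ y′ ⊎ Rotation (ℤ.- B₀) x y x′ y′

  Neighbour-sym : ∀ {x y x′ y′} → Neighbour x y x′ y′ → Neighbour x′ y′ x y
  Neighbour-sym {x} {y} {x′} {y′} (inj₁ rot) =
    inj₂ (Rotation-inverse B₀ norm₀ {x} {y} {x′} {y′} rot)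
  Neighbour-sym {x} {y} {x′} {y′} (inj₂ rot) =
    inj₁ (subst (λ B → Rotation B x′ y′ x y) (ℤ.neg-involutive B₀)
      (Rotation-inverse (ℤ.- B₀) norm₀⁻ {x} {y} {x′} {y′} rot))

  module _ {M : ℕ} {N : ℤ} (24M+1≡N : + (24 * M + 1) ≡ N) (P∣N : P ∣ℤ N) (P²∤N : ¬ P ℤ.* P ∣ℤ N) where

    not-both : ∀ {x y} → x ℤ.* x ℤ.+ + 24 ℤ.* (y ℤ.* y) ≡ N → P ∣ℤ x → ¬ P ∣ℤ y
    not-both form≡N (dividesℤ x₁ refl) (dividesℤ y₁ refl) =
      P²∤N (dividesℤ (x₁ ℤ.* x₁ ℤ.+ + 24 ℤ.* (y₁ ℤ.* y₁)) (trans (sym form≡N) (factor x₁ y₁ P)))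
      where
      factor : ∀ x y P → x ℤ.* P ℤ.* (x ℤ.* P) ℤ.+ + 24 ℤ.* (y ℤ.* P ℤ.* (y ℤ.* P)) ≡
        (x ℤ.* x ℤ.+ + 24 ℤ.* (y ℤ.* y)) ℤ.* (P ℤ.* P)
      factor = ℤ-Solver.solve-∀

    not-square : ∀ {x} → x ℤ.* x ≢ N
    not-square {x} x²≡N = not-both {x} {+ 0} (trans (ℤ.+-identityʳ (x ℤ.* x)) x²≡N)
      (euclid-square x (subst (P ∣ℤ_) (sym x²≡N) P∣N)) (dividesℤ (+ 0) refl)

    not-opposite : ∀ {x y x₁ y₁ x₂ y₂} → x ℤ.* x ℤ.+ + 24 ℤ.* (y ℤ.* y) ≡ N →
      Rotation B₀ x y x₁ y₁ → ¬ Rotation (ℤ.- B₀) x y x₂ y₂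
    not-opposite {x} {y} {x₁} {y₁} {x₂} {y₂} form≡N (_ , e₁) (_ , e₂) = not-both form≡N p∣x p∣y
      where
      identity-y : ∀ A B P x y y₁ y₂ → + 2 ℤ.* (A ℤ.* y) ℤ.- (y₁ ℤ.+ y₂) ℤ.* P ≡
        ℤ.- + 1 ℤ.* (P ℤ.* y₁ ℤ.- (A ℤ.* y ℤ.+ + 3 ℤ.* (B ℤ.* x)))
        ℤ.+ ℤ.- + 1 ℤ.* (P ℤ.* y₂ ℤ.- (A ℤ.* y ℤ.+ + 3 ℤ.* (ℤ.- B ℤ.* x)))
      identity-y = ℤ-Solver.solve-∀

      identity-x : ∀ A B P x y y₁ y₂ → + 6 ℤ.* (B ℤ.* x) ℤ.- (y₁ ℤ.- y₂) ℤ.* P ≡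
        ℤ.- + 1 ℤ.* (P ℤ.* y₁ ℤ.- (A ℤ.* y ℤ.+ + 3 ℤ.* (B ℤ.* x)))
        ℤ.+ + 1 ℤ.* (P ℤ.* y₂ ℤ.- (A ℤ.* y ℤ.+ + 3 ℤ.* (ℤ.- B ℤ.* x)))
      identity-x = ℤ-Solver.solve-∀

      p∣y : P ∣ℤ y
      p∣y = Sum.[ (λ p∣A → contradiction p∣A P∤A) , (λ h → h) ] (euclid A y
        (cancel-factor (+ 2) (+ 12) (A ℤ.* y) refl (dividesℤ (y₁ ℤ.+ y₂)
          (combine₂ (ℤ.- + 1) (ℤ.- + 1) e₁ e₂ (identity-y A B₀ P x y y₁ y₂)))))

      p∣x : P ∣ℤ x
      p∣x = Sum.[ (λ p∣B → contradiction p∣B P∤B) , (λ h → h) ] (euclid B₀ x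
        (cancel-factor (+ 6) (+ 4) (B₀ ℤ.* x) refl (dividesℤ (y₁ ℤ.- y₂)
          (combine₂ (ℤ.- + 1) (+ 1) e₁ e₂ (identity-x A B₀ P x y y₁ y₂)))))

    -- A fixed point would give 3BN = 0.
    not-fixed : ∀ B {x y} → B ≢ + 0 → x ℤ.* x ℤ.+ + 24 ℤ.* (y ℤ.* y) ≡ N → ¬ Rotation B x y x y
    not-fixed B {x} {y} B≢0 form≡N (ex , ey) =
      Sum.[ B≢0 , N≢0 ] (ℤ.i*j≡0⇒i≡0∨j≡0 B
        (ℤ.*-cancelˡ-≡ (+ 3) (B ℤ.* N) (+ 0)
          (trans (cong (λ z → + 3 ℤ.* (B ℤ.* z)) (sym form≡N))
            (combine₂ y (ℤ.- x) ex ey (identity A B P x y)))))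
      where
      N≢0 : N ≢ + 0
      N≢0 eq = ℕ.1+n≢0 (trans (ℕ.+-comm 1 (24 * M)) (ℤ.+-injective (trans 24M+1≡N eq)))

      identity : ∀ A B P x y →
        + 3 ℤ.* (B ℤ.* (x ℤ.* x ℤ.+ + 24 ℤ.* (y ℤ.* y))) ℤ.- + 0 ≡
        y ℤ.* (P ℤ.* x ℤ.- (A ℤ.* x ℤ.- + 72 ℤ.* (B ℤ.* y)))
        ℤ.+ ℤ.- x ℤ.* (P ℤ.* y ℤ.- (A ℤ.* y ℤ.+ + 3 ℤ.* (B ℤ.* x)))
      identity = ℤ-Solver.solve-∀

    S : ℤ × Maybe ℤ → Set
    S x = mixedWeight 1 x ≡ M

    R : ℤ × Maybe ℤ → ℤ × Maybe ℤ → Set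
    R (r , just k) (r′ , just k′) = Neighbour (X r) (Y k) (X r′) (Y k′)
    R _ _ = ⊥

    S⇒form : ∀ {r k} → S (r , just k) → X r ℤ.* X r ℤ.+ + 24 ℤ.* (Y k ℤ.* Y k) ≡ N
    S⇒form {r} {k} Sx = trans (sym (mixedWeight-just r k))
      (trans (cong (λ n → + (24 * n + 1)) Sx) 24M+1≡N)

    form⇒S : ∀ {r k} → X r ℤ.* X r ℤ.+ + 24 ℤ.* (Y k ℤ.* Y k) ≡ N → S (r , just k)
    form⇒S {r} {k} eq = ℕ.*-cancelˡ-≡ _ M 24 (ℕ.+-cancelʳ-≡ 1 _ _
      (ℤ.+-injective (trans (mixedWeight-just r k) (trans eq (sym 24M+1≡N)))))

    R-functional : ∀ x y z → S x → R x y → R x z → y ≡ z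
    R-functional (r , just k) (r₁ , just k₁) (r₂ , just k₂) Sx = neighbour-unique
      where
      rotation-unique : ∀ B → Rotation B (X r) (Y k) (X r₁) (Y k₁) →
        Rotation B (X r) (Y k) (X r₂) (Y k₂) → (r₁ , just k₁) ≡ (r₂ , just k₂)
      rotation-unique B rot₁ rot₂ = cong₂ (λ u v → u , just v)
        (X-injective r₁ r₂ (proj₁ unique)) (Y-injective k₁ k₂ (proj₂ unique))
        where unique = Rotation-unique B {X r} {Y k} {X r₁} {Y k₁} {X r₂} {Y k₂} rot₁ rot₂

      form = S⇒form {r} {k} Sx

      neighbour-unique : Neighbour (X r) (Y k) (X r₁) (Y k₁) → Neighbour (X r) (Y k) (X r₂) (Y k₂) →
        (r₁ , just k₁) ≡ (r₂ , just k₂)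
      neighbour-unique (inj₁ rot₁) (inj₁ rot₂) = rotation-unique B₀ rot₁ rot₂
      neighbour-unique (inj₂ rot₁) (inj₂ rot₂) = rotation-unique (ℤ.- B₀) rot₁ rot₂
      neighbour-unique (inj₁ rot₁) (inj₂ rot₂) = ⊥-elim
        (not-opposite {X r} {Y k} {X r₁} {Y k₁} {X r₂} {Y k₂} form rot₁ rot₂)
      neighbour-unique (inj₂ rot₁) (inj₁ rot₂) = ⊥-elim
        (not-opposite {X r} {Y k} {X r₂} {Y k₂} {X r₁} {Y k₁} form rot₂ rot₁)

    R-symmetric : ∀ x y → R x y → R y x
    R-symmetric (r , just k) (r′ , just k′) = Neighbour-sym {X r} {Y k} {X r′} {Y k′}

    B₀≢0 : B₀ ≢ + 0
    B₀≢0 eq = P∤B (dividesℤ (+ 0) eq)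

    R-irreflexive : ∀ x → S x → ¬ R x x
    R-irreflexive (r , just k) Sx (inj₁ rot) = not-fixed B₀ {X r} {Y k} B₀≢0 (S⇒form {r} {k} Sx) rot
    R-irreflexive (r , just k) Sx (inj₂ rot) =
      not-fixed (ℤ.- B₀) {X r} {Y k} (λ eq → B₀≢0 (ℤ.neg-injective eq)) (S⇒form {r} {k} Sx) rot

    P∣product : ∀ {x y} → x ℤ.* x ℤ.+ + 24 ℤ.* (y ℤ.* y) ≡ N →
      P ∣ℤ (A ℤ.* y ℤ.+ + 3 ℤ.* (B₀ ℤ.* x)) ℤ.* (A ℤ.* y ℤ.+ + 3 ℤ.* (ℤ.- B₀ ℤ.* x))
    P∣product {x} {y} form≡N = product (subst (P ∣ℤ_) (sym form≡N) P∣N)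
      where
      identity : ∀ A B P x y q →
        (A ℤ.* y ℤ.+ + 3 ℤ.* (B ℤ.* x)) ℤ.* (A ℤ.* y ℤ.+ + 3 ℤ.* (ℤ.- B ℤ.* x))
          ℤ.- (P ℤ.* (y ℤ.* y) ℤ.- + 9 ℤ.* (B ℤ.* B ℤ.* q)) ℤ.* P ≡
        y ℤ.* y ℤ.* (A ℤ.* A ℤ.+ + 216 ℤ.* (B ℤ.* B) ℤ.- P ℤ.* P)
        ℤ.+ ℤ.- (+ 9 ℤ.* (B ℤ.* B)) ℤ.* (x ℤ.* x ℤ.+ + 24 ℤ.* (y ℤ.* y) ℤ.- q ℤ.* P)
      identity = ℤ-Solver.solve-∀

      product : P ∣ℤ x ℤ.* x ℤ.+ + 24 ℤ.* (y ℤ.* y) → _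
      product (dividesℤ q eq) = dividesℤ (P ℤ.* (y ℤ.* y) ℤ.- + 9 ℤ.* (B₀ ℤ.* B₀ ℤ.* q))
        (combine₂ (y ℤ.* y) (ℤ.- (+ 9 ℤ.* (B₀ ℤ.* B₀))) norm₀ eq (identity A B₀ P x y q))

    R-partner : ∀ x → S x → ∃ λ y → S y × R x y
    R-partner (r , nothing) Sx = contradiction
      (trans (sym (mixedWeight-nothing r)) (trans (cong (λ n → + (24 * n + 1)) Sx) 24M+1≡N))
      (not-square {X r})
    R-partner (r , just k) Sx =
      Sum.[ (λ P∣b → rotate B₀ inj₁ (Rotation-exists B₀ norm₀ r k P∣b))
          , (λ P∣b → rotate (ℤ.- B₀) inj₂ (Rotation-exists (ℤ.- B₀) norm₀⁻ r k P∣b)) ]′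
        (euclid (A ℤ.* Y k ℤ.+ + 3 ℤ.* (B₀ ℤ.* X r)) (A ℤ.* Y k ℤ.+ + 3 ℤ.* (ℤ.- B₀ ℤ.* X r))
          (P∣product {X r} {Y k} form))
      where
      form = S⇒form {r} {k} Sx

      rotate : ∀ B →
        (∀ {r′ k′} → Rotation B (X r) (Y k) (X r′) (Y k′) → Neighbour (X r) (Y k) (X r′) (Y k′)) →
        (∃ λ r′ → ∃ λ k′ → Rotation B (X r) (Y k) (X r′) (Y k′) ×
          X r′ ℤ.* X r′ ℤ.+ + 24 ℤ.* (Y k′ ℤ.* Y k′) ≡ X r ℤ.* X r ℤ.+ + 24 ℤ.* (Y k ℤ.* Y k)) →
        ∃ λ y → S y × R (r , just k) y
      rotate B neighbour (r′ , k′ , rot , form≡) =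
        (r′ , just k′) , form⇒S {r′} {k′} (trans form≡ form) , neighbour {r′} {k′} rot

    matching : PerfectMatching S R
    matching = record
      { symmetric = λ {x} {y} → R-symmetric x y
      ; irreflexive = λ {x} → R-irreflexive x
      ; functional = λ {x} {y} {z} Sx _ _ → R-functional x y z Sx
      ; partner = λ {x} → R-partner x }

    coefficient≡0 : (pentSeries 1 ⊛ squareSeries) M ≡ 0ℙ
    coefficient≡0 = matching⇒even matching
      (Represents-⊛ (Represents-pent 1 (s≤s z≤n)) Represents-square M)

parity≡0⇒2∣ : ∀ k → parity k ≡ 0ℙ → 2 ∣ k
parity≡0⇒2∣ zero _ = ℕ∣._∣0 2
parity≡0⇒2∣ (suc (suc k)) eq = ℕ∣.∣m∣n⇒∣m+n ℕ∣.∣-refl (parity≡0⇒2∣ k eq)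

self-inverse-mod24 : ∀ (i j : Fin 24) → (toℕ i * toℕ j) % 24 ≡ 1 → i ≡ j
self-inverse-mod24 = toWitness {a? = Fin.all? λ i → Fin.all? λ j →
  ((toℕ i * toℕ j) % 24 ℕ.≟ 1) →-dec (i Fin.≟ j)} _

residue-mod24 : ∀ {c p m} → c < 24 → 24 * m + 1 ≡ c * p → c ≡ p % 24
residue-mod24 {c} {p} {m} c<24 eq = begin
  c                            ≡⟨ Fin.toℕ-fromℕ< c<24 ⟨
  toℕ (fromℕ< c<24)            ≡⟨ cong toℕ (self-inverse-mod24 (fromℕ< c<24) (fromℕ< r<24) product) ⟩
  toℕ (fromℕ< r<24)            ≡⟨ Fin.toℕ-fromℕ< r<24 ⟩
  p % 24 ∎
  where
  open ≡-Reasoning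
  r<24 = m%n<n p 24

  regroup : ∀ m → 24 * m + 1 ≡ 1 + m * 24
  regroup = ℕ-Solver.solve-∀

  product : (toℕ (fromℕ< c<24) * toℕ (fromℕ< r<24)) % 24 ≡ 1
  product = begin
    (toℕ (fromℕ< c<24) * toℕ (fromℕ< r<24)) % 24
      ≡⟨ cong₂ (λ x y → (x * y) % 24) (Fin.toℕ-fromℕ< c<24) (Fin.toℕ-fromℕ< r<24) ⟩
    (c * (p % 24)) % 24         ≡⟨ cong (λ x → (x * (p % 24)) % 24) (m<n⇒m%n≡m c<24) ⟨
    ((c % 24) * (p % 24)) % 24  ≡⟨ %-distribˡ-* c p 24 ⟨
    (c * p) % 24                ≡⟨ cong (_% 24) eq ⟨
    (24 * m + 1) % 24           ≡⟨ cong (_% 24) (regroup m) ⟩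
    (1 + m * 24) % 24           ≡⟨ [m+kn]%n≡m%n 1 m 24 ⟩
    1 ∎

multiple-<⇒≡0 : ∀ {p d} → p ∣ d → d < p → d ≡ 0
multiple-<⇒≡0 {d = zero} _ _ = refl
multiple-<⇒≡0 {d = suc d} p∣d d<p = contradiction p∣d (>⇒∤ d<p)

-- The only α < p with p² ∣ 24 (p α + m) + 1 = p (24 α + c) is ⌊p/24⌋, because c = p mod 24.
divisible⇒α≡p/24 : ∀ {p c m α} → Prime p → m + 1 ≤ p → 24 * m + 1 ≡ c * p → α < p →
  p ∣ 24 * α + c → α ≡ p / 24
divisible⇒α≡p/24 {p} {c} {m} {α} prime-p m<p eq α<p p∣24α+c =
  ℤ.+-injective (ℤ.i-j≡0⇒i≡j (+ α) (+ (p / 24)) (ℤ.∣i∣≡0⇒i≡0 (multiple-<⇒≡0 p∣distance distance<p)))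
  where
  instance _ = prime⇒nonZero prime-p

  c<24 : c < 24
  c<24 = ℕ.*-cancelʳ-< p c 24 (ℕ.<-≤-trans (subst (_< 24 * (m + 1)) eq 24m+1<24m+24)
    (ℕ.*-monoʳ-≤ 24 m<p))
    where
    24m+1<24m+24 : 24 * m + 1 < 24 * (m + 1)
    24m+1<24m+24 = subst (24 * m + 1 <_) (sym (ℕ.*-distribˡ-+ 24 m 1))
      (ℕ.+-monoʳ-< (24 * m) (s≤s (s≤s z≤n)))

  p≡ : p ≡ c + p / 24 * 24
  p≡ = trans (m≡m%n+[m/n]*n p 24) (cong (λ r → r + p / 24 * 24) (sym (residue-mod24 {m = m} c<24 eq)))

  c*p≡ : + c ℤ.* + p ≡ + 24 ℤ.* + m ℤ.+ + 1
  c*p≡ = trans (sym (ℤ.pos-* c p)) (trans (cong +_ (sym eq)) (cong (ℤ._+ + 1) (ℤ.pos-* 24 m)))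

  p≡ℤ : + p ≡ + c ℤ.+ + (p / 24) ℤ.* + 24
  p≡ℤ = trans (cong +_ p≡) (cong (λ z → + c ℤ.+ z) (ℤ.pos-* (p / 24) 24))

  difference : ∀ {P} x y z → P ≡ z ℤ.+ y ℤ.* + 24 →
    + 24 ℤ.* x ℤ.+ z ℤ.- P ≡ + 24 ℤ.* (x ℤ.- y)
  difference x y z refl = collect x y z
    where
    collect : ∀ x y z → + 24 ℤ.* x ℤ.+ z ℤ.- (z ℤ.+ y ℤ.* + 24) ≡ + 24 ℤ.* (x ℤ.- y)
    collect = ℤ-Solver.solve-∀

  p∣24α+cℤ : + p ∣ℤ + 24 ℤ.* + α ℤ.+ + c
  p∣24α+cℤ = subst (λ z → + p ∣ℤ z ℤ.+ + c) (ℤ.pos-* 24 α) (ℤ∣.∣ᵤ⇒∣ p∣24α+c)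

  p∣distance : p ∣ ∣ + α ℤ.- + (p / 24) ∣
  p∣distance = ℤ∣.∣⇒∣ᵤ (PrimeTo6.cancel24 (prime⇒primeElement prime-p) {+ m} {+ c} c*p≡
    (+ α ℤ.- + (p / 24)) (subst (+ p ∣ℤ_) (difference (+ α) (+ (p / 24)) (+ c) p≡ℤ)
      (ℤ∣.∣m∣n⇒∣m-n p∣24α+cℤ ℤ∣.∣-refl)))

  distance<p : ∣ + α ℤ.- + (p / 24) ∣ < p
  distance<p = ℕ.≤-<-trans
    (subst (λ z → ∣ z ∣ ≤ α ⊔ p / 24) (sym (ℤ.m-n≡m⊖n α (p / 24))) (ℤ.∣m⊝n∣≤m⊔n α (p / 24)))
    (ℕ.⊔-pres-<m α<p (m/n<m p 24 (s≤s (s≤s z≤n))))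

InP⇒NormSquare : ∀ {p} → InP p → {m c : ℤ} → c ℤ.* + p ≡ + 24 ℤ.* m ℤ.+ + 1 → NormSquare (+ p)
InP⇒NormSquare {p} (prime-p , j , j∈ , x , y , _ , eq) {m} {c} c*p≡ with j∈
... | inj₁ refl = form₁⇒NormSquare x y (trans eq (ℤ.pos-* 1 p))
  where open PrimeTo6 (prime⇒primeElement prime-p) {m} {c} c*p≡
... | inj₂ (inj₁ refl) = form₄⇒NormSquare x y (trans eq (ℤ.pos-* 4 p))
  where open PrimeTo6 (prime⇒primeElement prime-p) {m} {c} c*p≡
... | inj₂ (inj₂ refl) = form₈⇒NormSquare x y (trans eq (ℤ.pos-* 8 p))
  where open PrimeTo6 (prime⇒primeElement prime-p) {m} {c} c*p≡

theorem1p3 : (p : ℕ) → InP p → (n : ℕ) → (m : ℕ) → 1 ≤ m → m + 1 ≤ p → p ∣ 24 * m + 1 →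
    (α : ℕ) → α < p → α ≢ p / 24 →
    2 ∣ b₃ (2 * (p ^ 2 * n + p * α + m))
theorem1p3 p p∈P n m _ m<p (divides c eq) α α<p α≢ = parity≡0⇒2∣ (b₃ (2 * M))
  (trans (b₃-even M) (RotationMatching.coefficient≡0 (prime⇒primeElement prime-p) {+ m} {+ c} c*p≡
    (InP⇒NormSquare p∈P {+ m} {+ c} c*p≡) {M} refl (ℤ∣.∣ᵤ⇒∣ p∣N) (p²∤N ∘ ℤ∣.∣⇒∣ᵤ)))
  where
  prime-p = proj₁ p∈P
  M = p ^ 2 * n + p * α + m
  instance _ = prime⇒nonZero prime-p

  c*p≡ : + c ℤ.* + p ≡ + 24 ℤ.* + m ℤ.+ + 1
  c*p≡ = trans (sym (ℤ.pos-* c p)) (trans (cong +_ (sym eq)) (cong (ℤ._+ + 1) (ℤ.pos-* 24 m)))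

  factor : 24 * M + 1 ≡ p * (p * (24 * n) + (24 * α + c))
  factor = trans (expand p n α m)
    (trans (cong (λ k → p * (p * (24 * n) + 24 * α) + k) eq) (collect p n α c))
    where
    expand : ∀ p n α m → 24 * (p * (p * 1) * n + p * α + m) + 1 ≡
      p * (p * (24 * n) + 24 * α) + (24 * m + 1)
    expand = ℕ-Solver.solve-∀

    collect : ∀ p n α c → p * (p * (24 * n) + 24 * α) + c * p ≡ p * (p * (24 * n) + (24 * α + c))
    collect = ℕ-Solver.solve-∀

  p∣N : p ∣ 24 * M + 1
  p∣N = subst (p ∣_) (sym factor) (ℕ∣.m∣m*n _)

  p²∤N : ¬ ∣ + p ℤ.* + p ∣ ∣ 24 * M + 1
  p²∤N p²∣N = α≢ (divisible⇒α≡p/24 {m = m} prime-p m<p eq α<p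
    (ℕ∣.∣m+n∣m⇒∣n (ℕ∣.*-cancelˡ-∣ p (subst (p * p ∣_) factor
      (subst (_∣ 24 * M + 1) (ℤ.abs-* (+ p) (+ p)) p²∣N))) (ℕ∣.m∣m*n (24 * n))))
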